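{- Let $X$ be a proper hereditary subclass of the class of unit interval graphs. Then the clique-width of graphs in $X$ is bounded by a constant; that is, there is a constant $c$ (depending only on $X$) such that every graph in $X$ has clique-width at most $c$.
   Context: All graphs are finite, simple and undirected. A graph is a unit interval graph if it is the intersection graph of a family of (closed) intervals of the real line all having the same length. A class of graphs (closed under isomorphism) is hereditary if with any graph it contains all induced subgraphs of that graph. A subclass of the class of unit interval graphs is proper if at least one unit interval graph does not belong to it. The clique-width of a graph $G$ is the minimum number of labels needed to construct $G$ by means of the following four operations on labeled graphs: (i) creation of a new vertex $v$ with label $i$; (ii) disjoint union of two labeled graphs; (iii) joining by an edge each vertex with label $i$ to each vertex with label $j$, where $i\ne j$; (iv) renaming label $i$ to $j$. -}

module Defs where

open import Data.Bool.Base using (if_then_else_)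
open import Data.Empty using (⊥)
open import Data.Fin.Base using (Fin; splitAt)
open import Data.Fin.Properties using (_≟_)
open import Data.Nat.Base as ℕ using (ℕ)
import Data.Nat.Properties as ℕ
open import Data.Product.Base using (∃-syntax; Σ-syntax; _×_; _,_)
open import Data.Rational.Base as ℚ using (ℚ; 0ℚ; ½)
import Data.Rational.Properties as ℚ
open import Data.Rational.Solver using (module +-*-Solver)
open import Data.Sum.Base as Sum using (_⊎_; inj₁; inj₂; [_,_]′)
open import Data.Sum.Relation.Binary.Pointwise
  using (Pointwise; inj₁; inj₂; ⊎-symmetric; ⊎-decidable)
open import Function.Base using (_on_; _∘_)
open import Function.Bundles using (_⇔_; _↣_; _↔_; Injection; Inverse)
open import Level using (0ℓ)
open import Relation.Binary.Core using (Rel)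
open import Relation.Binary.Definitions using (Decidable; Symmetric)
open import Relation.Binary.PropositionalEquality
  using (_≡_; _≢_; refl; sym; trans; cong)
open import Relation.Nullary.Decidable using (no; _×-dec_; _⊎-dec_; does)
open import Relation.Nullary.Negation using (¬_)
open import Relation.Unary using (Pred; _⊆_; _∩_; ∁; Satisfiable)

------------------------------------------------------------------------
-- The real line: Cauchy sequences of rationals, taken up to _≃_.

record ℝ : Set where
  field
    seq    : ℕ → ℚ
    cauchy : ∀ ε → 0ℚ ℚ.< ε → ∃[ N ] ∀ m n → N ℕ.≤ m → N ℕ.≤ n →
             ℚ.∣ seq m ℚ.- seq n ∣ ℚ.< ε

open ℝ

infix  4 _≤_ _≃_
infixl 6 _-_

_≤_ : Rel ℝ 0ℓ
x ≤ y = ∀ ε → 0ℚ ℚ.< ε → ∃[ N ] ∀ n → N ℕ.≤ n → seq x n ℚ.≤ seq y n ℚ.+ ε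

_≃_ : Rel ℝ 0ℓ
x ≃ y = x ≤ y × y ≤ x

_-_ : ℝ → ℝ → ℝ
(x - y) .seq n = seq x n ℚ.- seq y n
(x - y) .cauchy ε 0<ε
  with cauchy x (½ ℚ.* ε) 0<½ε | cauchy y (½ ℚ.* ε) 0<½ε
  where
  0<½ε : 0ℚ ℚ.< ½ ℚ.* ε
  0<½ε = ℚ.*-monoʳ-<-pos ½ 0<ε
... | M , x-close | N , y-close = M ℕ.⊔ N , close
  where
  rearrange : ∀ a b c d →
              (a ℚ.- b) ℚ.- (c ℚ.- d) ≡ (a ℚ.- c) ℚ.- (b ℚ.- d)
  rearrange = solve 4 (λ a b c d →
    (a :- b) :- (c :- d) := (a :- c) :- (b :- d)) refl
    where open +-*-Solver

  halves : ½ ℚ.* ε ℚ.+ ½ ℚ.* ε ≡ ε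
  halves = trans (sym (ℚ.*-distribʳ-+ ε ½ ½)) (ℚ.*-identityˡ ε)

  close : ∀ m n → M ℕ.⊔ N ℕ.≤ m → M ℕ.⊔ N ℕ.≤ n →
          ℚ.∣ (seq x m ℚ.- seq y m) ℚ.- (seq x n ℚ.- seq y n) ∣ ℚ.< ε
  close m n ≤m ≤n = begin-strict
    ℚ.∣ (seq x m ℚ.- seq y m) ℚ.- (seq x n ℚ.- seq y n) ∣
      ≡⟨ cong ℚ.∣_∣ (rearrange (seq x m) (seq y m) (seq x n) (seq y n)) ⟩
    ℚ.∣ (seq x m ℚ.- seq x n) ℚ.- (seq y m ℚ.- seq y n) ∣
      ≤⟨ ℚ.∣p-q∣≤∣p∣+∣q∣ (seq x m ℚ.- seq x n) (seq y m ℚ.- seq y n) ⟩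
    ℚ.∣ seq x m ℚ.- seq x n ∣ ℚ.+ ℚ.∣ seq y m ℚ.- seq y n ∣
      <⟨ ℚ.+-mono-<
           (x-close m n (ℕ.m⊔n≤o⇒m≤o M N ≤m) (ℕ.m⊔n≤o⇒m≤o M N ≤n))
           (y-close m n (ℕ.m⊔n≤o⇒n≤o M N ≤m) (ℕ.m⊔n≤o⇒n≤o M N ≤n)) ⟩
    ½ ℚ.* ε ℚ.+ ½ ℚ.* ε
      ≡⟨ halves ⟩
    ε ∎
    where open ℚ.≤-Reasoning

record ClosedInterval : Set where
  field
    left right : ℝ
    left≤right : left ≤ right

  length : ℝ
  length = right - left

open ClosedInterval

infix 4 _∈_

_∈_ : ℝ → ClosedInterval → Set
x ∈ I = left I ≤ x × x ≤ right I

------------------------------------------------------------------------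
-- Graphs

record Graph : Set₁ where
  infix 4 _~_ _~?_
  field
    order  : ℕ
    _~_    : Rel (Fin order) 0ℓ
    _~?_   : Decidable _~_
    ~-sym  : Symmetric _~_
    ~-irr  : ∀ {u} → ¬ (u ~ u)

  Vertex : Set
  Vertex = Fin order

infix 4 _≅_ _≼_

_≅_ : Graph → Graph → Set
G ≅ H = Σ[ f ∈ G.Vertex ↔ H.Vertex ]
        ∀ u v → (u G.~ v) ⇔ (Inverse.to f u H.~ Inverse.to f v)
  where module G = Graph G; module H = Graph H

-- H ≼ G: up to isomorphism, H is an induced subgraph of G.
_≼_ : Graph → Graph → Set
H ≼ G = Σ[ f ∈ H.Vertex ↣ G.Vertex ]
        ∀ u v → (u H.~ v) ⇔ (Injection.to f u G.~ Injection.to f v)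
  where module G = Graph G; module H = Graph H

UnitInterval : Pred Graph 0ℓ
UnitInterval G = Σ[ I ∈ (G.Vertex → ClosedInterval) ]
  (∀ u v → length (I u) ≃ length (I v)) ×
  (∀ u v → (u G.~ v) ⇔ (u ≢ v × ∃[ x ] x ∈ I u × x ∈ I v))
  where module G = Graph G

-- Vertex sets are always of the form Fin n, so an induced subgraph is only
-- available up to isomorphism.  Since G ≅ H implies G ≼ H and H ≼ G, this
-- includes closure under isomorphism.
Hereditary : ∀ {ℓ} → Pred Graph ℓ → Set _
Hereditary X = ∀ G H → H ≼ G → X G → X H

ProperSubclassOfUnitInterval : ∀ {ℓ} → Pred Graph ℓ → Set _
ProperSubclassOfUnitInterval X =
  X ⊆ UnitInterval × Satisfiable (UnitInterval ∩ ∁ X)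

------------------------------------------------------------------------
-- Clique-width

record LabelledGraph (k : ℕ) : Set₁ where
  field
    graph : Graph
    label : Graph.Vertex graph → Fin k

  open Graph graph public

module _ {k : ℕ} where

  singleton : Fin k → LabelledGraph k
  singleton i = record
    { graph = record
      { order = 1
      ; _~_   = λ _ _ → ⊥
      ; _~?_  = λ _ _ → no λ()
      ; ~-sym = λ ()
      ; ~-irr = λ ()
      }
    ; label = λ _ → i
    }

  disjointUnion : LabelledGraph k → LabelledGraph k → LabelledGraph k
  disjointUnion G H = record
    { graph = record
      { order = G.order ℕ.+ H.order
      ; _~_   = Pointwise G._~_ H._~_ on splitAt G.order
      ; _~?_  = λ u v → ⊎-decidable G._~?_ H._~?_ (splitAt G.order u) (splitAt G.order v)
      ; ~-sym = ⊎-symmetric G.~-sym H.~-sym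
      ; ~-irr = λ {u} → irr (splitAt G.order u)
      }
    ; label = [ G.label , H.label ]′ ∘ splitAt G.order
    }
    where
    module G = LabelledGraph G
    module H = LabelledGraph H

    irr : ∀ w → ¬ Pointwise G._~_ H._~_ w w
    irr _ (inj₁ u~u) = G.~-irr u~u
    irr _ (inj₂ v~v) = H.~-irr v~v

  join : (i j : Fin k) → i ≢ j → LabelledGraph k → LabelledGraph k
  join i j i≢j G = record
    { graph = record
      { order = order
      ; _~_   = λ u v → u ~ v ⊎ Joined u v ⊎ Joined v u
      ; _~?_  = λ u v → u ~? v ⊎-dec joined? u v ⊎-dec joined? v u
      ; ~-sym = Sum.map ~-sym Sum.swap
      ; ~-irr = λ where
          (inj₁ u~u)        → ~-irr u~u
          (inj₂ (inj₁ u-u)) → irr u-u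
          (inj₂ (inj₂ u-u)) → irr u-u
      }
    ; label = label
    }
    where
    open LabelledGraph G

    Joined : Rel Vertex 0ℓ
    Joined u v = label u ≡ i × label v ≡ j

    joined? : Decidable Joined
    joined? u v = label u ≟ i ×-dec label v ≟ j

    irr : ∀ {u} → ¬ Joined u u
    irr (u≡i , u≡j) = i≢j (trans (sym u≡i) u≡j)

  rename : Fin k → Fin k → LabelledGraph k → LabelledGraph k
  rename i j G = record
    { graph = graph
    ; label = λ u → if does (label u ≟ i) then j else label u
    }
    where open LabelledGraph G

data Expression (k : ℕ) : Set where
  new : Fin k → Expression k
  _⊕_ : Expression k → Expression k → Expression k
  η   : (i j : Fin k) → i ≢ j → Expression k → Expression k
  ρ   : Fin k → Fin k → Expression k → Expression k

⟦_⟧ : ∀ {k} → Expression k → LabelledGraph k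
⟦ new i ⟧       = singleton i
⟦ e ⊕ f ⟧       = disjointUnion ⟦ e ⟧ ⟦ f ⟧
⟦ η i j i≢j e ⟧ = join i j i≢j ⟦ e ⟧
⟦ ρ i j e ⟧     = rename i j ⟦ e ⟧

-- Every expression yields at least one vertex.  The graph without vertices
-- needs no operation and no label, so its clique-width is 0.
ConstructibleWith : ℕ → Pred Graph 0ℓ
ConstructibleWith k G =
  Graph.order G ≡ 0 ⊎ (Σ[ e ∈ Expression k ] LabelledGraph.graph ⟦ e ⟧ ≅ G)

-- The least k with ConstructibleWith k G is at most c.
CliqueWidthAtMost : ℕ → Pred Graph 0ℓ
CliqueWidthAtMost c G = ∃[ k ] k ℕ.≤ c × ConstructibleWith k G

{-# OPTIONS --safe #-}
module Submission where

-- Idea.  Sort the vertices of a unit interval graph by the left endpoints of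
-- their intervals, and send each position a to f a, the first later position
-- not adjacent to it.  Then f is monotone, a < f a, and positions a < b are
-- adjacent exactly when b < f a.  Iterating f from 0 cuts the line into
-- consecutive columns; each column is a clique, and edges leave a column only
-- to the columns next to it.  Following f also sends each column into the
-- next one, which yields a total preorder on all positions, the row order ⊑:
-- between a column and its successor, a vertex u of the first is adjacent to
-- a vertex v of the second exactly when v precedes u in this order.
--
-- Let H be a unit interval graph outside X with h vertices, and group the
-- columns of a graph G in X into windows of 2 + h columns.  A jump is a
-- position t such that t and t + 1 still have different images after 1 + h
-- steps of f.
--
-- If the first column of some window has more than h jumps, then the images
-- of h of them form a grid that contains every unit interval graph on h
-- vertices (Embedding): place a vertex by its column and by its rank in the
-- row order.  As X is hereditary and omits H, this does not happen in G.
--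
-- So every window has at most h jumps.  Each vertex v of a window lies
-- between the trajectories of some τ v and of τ v + 1, where τ v is in the
-- first column.  Call v a right vertex if τ v is a jump and v is not in the
-- first column, and a left vertex otherwise.  Then the left and the right
-- vertices of a window form a cut described by boundedly many classes: the
-- adjacency of a left and a right vertex depends only on their columns and on
-- how many jumps precede their τ.  The last column is entirely right and the
-- first entirely left, so the right vertices of a window together with the
-- left vertices of the next form a block, and vertices of different blocks
-- are adjacent only across the left-right cut of a single window.  Order the
-- vertices by block, and by row order within a block.  Every initial segment
-- of this order meets the rest in boundedly many neighbourhoods
-- (colour-twins), and such an order yields an expression with boundedly many
-- labels (Sweep).
--
-- Comparisons of reals are undecidable, but only finitely many are needed.
-- An umbrella order of the vertices therefore cannot fail to exist, and as
-- there are finitely many orders to check, one is found by search (umbrella).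

open import Defs
  renaming (_≤_ to _≤ᴿ_; _-_ to _-ᴿ_; _∈_ to _∈ᴿ_; _≃_ to _≃ᴿ_)
open import Data.Bool.Base using (if_then_else_)
open import Data.Empty using (⊥)
open import Data.Fin.Base as Fin using (Fin; fromℕ<; combine; punchIn; splitAt)
open import Data.Fin.Permutation as Perm
  using (Permutation′; _⟨$⟩ʳ_; _⟨$⟩ˡ_; _≈_; inverseˡ; inverseʳ; insert; remove; insert-remove)
open import Data.Fin.Properties as Fin
  using (any?; all?; combine-injective; pigeonhole; +↔⊎)
open import Data.List.Base using (List; []; _∷_; map; filter; allFin)
open import Data.List.Membership.Propositional using (_∈_)
open import Data.List.Membership.Propositional.Properties
  using (∈-map⁺; ∈-map⁻; ∈-filter⁺; ∈-filter⁻; ∈-allFin)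
open import Data.List.Relation.Unary.Any using (here; there)
open import Data.Nat.Base
  using (ℕ; zero; suc; _+_; _*_; _∸_; _⊔_; _≤_; _<_; z≤n; s≤s)
open import Data.Nat.GeneralisedArithmetic using (fold; fold-+)
open import Data.Nat.Properties
open import Data.Product.Base
  using (∃; ∃-syntax; Σ-syntax; _×_; _,_; proj₁; proj₂)
open import Data.Rational.Base as ℚ using (0ℚ; ½)
import Data.Rational.Properties as ℚ
open import Data.Rational.Solver using (module +-*-Solver)
open import Data.Sum.Base as Sum using (_⊎_; inj₁; inj₂; [_,_]′; swap)
open import Data.Sum.Function.Propositional using (_⊎-↔_)
open import Data.Sum.Relation.Binary.Pointwise using (Pointwise; inj₁; inj₂)
open import Effect.Monad using (RawMonad)
open import Function.Base using (_∘_; id; const; _on_)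
open import Function.Bundles using (_⇔_; _↔_; mk⇔; mk↣; Equivalence; Inverse)
open import Function.Construct.Composition using (_↔-∘_; _⇔-∘_)
open import Function.Construct.Identity using (↔-id; ⇔-id)
open import Function.Construct.Symmetry using (⇔-sym; ↔-sym)
open import Level using (Level; 0ℓ)
open import Relation.Binary.Core using (Rel)
open import Relation.Binary.Definitions using (tri<; tri≈; tri>; Decidable; Symmetric)
open import Relation.Binary.PropositionalEquality
  using (_≡_; _≢_; refl; sym; trans; cong; subst; subst₂)
open import Relation.Nullary.Decidable
  using (Dec; yes; no; does; map′; _×-dec_; _⊎-dec_; _→-dec_; ¬?; decidable-stable; ¬¬-excluded-middle)
open import Relation.Nullary.Negation using (¬_; contradiction; ¬¬-map; ¬¬-Monad)
open import Relation.Unary using (Pred)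

open Equivalence using () renaming (to to ⇒; from to ⇐)

------------------------------------------------------------------------
-- Searching the natural numbers

-- A discrete intermediate value theorem; F need not be monotone.
crossing : ∀ (F : ℕ → ℕ) {v} d s → F s ≤ v → v < F (d + s) →
           ∃[ t ] s ≤ t × t < d + s × F t ≤ v × v < F (suc t)
crossing F zero s Fs≤v v<Fs = contradiction v<Fs (≤⇒≯ Fs≤v)
crossing F {v} (suc d) s Fs≤v v<F with F (d + s) ≤? v
... | yes F≤v = d + s , m≤n+m s d , ≤-refl , F≤v , v<F
... | no  F≰v with crossing F d s Fs≤v (≰⇒> F≰v)
...   | t , s≤t , t< , Ft≤v , v<Ft = t , s≤t , m<n⇒m<1+n t< , Ft≤v , v<Ft

-- The first failure of P at s or later, below a known failure.
first-failure : ∀ {P : ℕ → Set} → (∀ x → Dec (P x)) → ∀ d s → ¬ P (d + s) →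
                ∃[ b ] s ≤ b × ¬ P b × ∀ {x} → s ≤ x → x < b → P x
first-failure P? zero    s ¬P = s , ≤-refl , ¬P , λ s≤x x<s → contradiction x<s (≤⇒≯ s≤x)
first-failure {P} P? (suc d) s ¬P with P? s
... | no ¬Ps = s , ≤-refl , ¬Ps , λ s≤x x<s → contradiction x<s (≤⇒≯ s≤x)
... | yes Ps with first-failure P? d (suc s) (subst (¬_ ∘ P) (sym (+-suc d s)) ¬P)
...   | b , s<b , ¬Pb , below = b , <⇒≤ s<b , ¬Pb , λ s≤x x<b →
        [ (λ s<x → below s<x x<b) , (λ s≡x → subst P s≡x Ps) ]′ (m≤n⇒m<n∨m≡n s≤x)

------------------------------------------------------------------------
-- Columns and rows

-- The graph on ℕ encoded by f: each a is adjacent to exactly the b with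
-- a < b < f a and, symmetrically, to the b with b < a < f b.
Adjacent : (ℕ → ℕ) → ℕ → ℕ → Set
Adjacent f a b = (a < b × b < f a) ⊎ (b < a × a < f b)

module Columns (f : ℕ → ℕ)
               (f-mono : ∀ {a b} → a ≤ b → f a ≤ f b)
               (f-infl : ∀ a → a < f a) where

  -- F d is the d-th iterate of f.
  F : ℕ → ℕ → ℕ
  F d a = fold a f d

  F-+ : ∀ d e a → F (d + e) a ≡ F d (F e a)
  F-+ d e a = fold-+ a f d

  F-mono : ∀ d {a b} → a ≤ b → F d a ≤ F d b
  F-mono zero    a≤b = a≤b
  F-mono (suc d) a≤b = f-mono (F-mono d a≤b)

  F-cancel-< : ∀ d {a b} → F d a < F d b → a < b
  F-cancel-< d Fa<Fb = ≰⇒> (λ b≤a → <⇒≱ Fa<Fb (F-mono d b≤a))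

  -- Column i consists of the v with start i ≤ v < start (suc i).
  start : ℕ → ℕ
  start i = F i 0

  start-mono : ∀ {i j} → i ≤ j → start i ≤ start j
  start-mono z≤n = z≤n
  start-mono (s≤s i≤j) = f-mono (start-mono i≤j)

  start-cancel-< : ∀ {i j} → start i < start j → i < j
  start-cancel-< s<s = ≰⇒> (λ j≤i → <⇒≱ s<s (start-mono j≤i))

  i≤start : ∀ i → i ≤ start i
  i≤start zero    = z≤n
  i≤start (suc i) = ≤-<-trans (i≤start i) (f-infl _)

  private
    abstract
      column : ∀ v → ∃[ i ] 0 ≤ i × i < suc v + 0 × start i ≤ v × v < start (suc i)
      column v = crossing start (suc v) 0 z≤n
        (subst (λ k → v < start k) (sym (+-identityʳ (suc v))) (i≤start (suc v)))

  -- The column of v; it is determined by start-col and <-start-col.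
  col : ℕ → ℕ
  col v = proj₁ (column v)

  col≤ : ∀ v → col v ≤ v
  col≤ v = subst (col v ≤_) (+-identityʳ v) (≤-pred (proj₁ (proj₂ (proj₂ (column v)))))

  start-col : ∀ v → start (col v) ≤ v
  start-col v = proj₁ (proj₂ (proj₂ (proj₂ (column v))))

  <-start-col : ∀ v → v < start (suc (col v))
  <-start-col v = proj₂ (proj₂ (proj₂ (proj₂ (column v))))

  col-unique : ∀ {i v} → start i ≤ v → v < start (suc i) → col v ≡ i
  col-unique {i} {v} s≤v v<s = ≤-antisym
    (≤-pred (start-cancel-< (≤-<-trans (start-col v) v<s)))
    (≤-pred (start-cancel-< (≤-<-trans s≤v (<-start-col v))))

  col-mono : ∀ {a b} → a ≤ b → col a ≤ col b
  col-mono {a} {b} a≤b = ≤-pred (start-cancel-<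
    (≤-<-trans (start-col a) (≤-<-trans a≤b (<-start-col b))))

  col-cancel-< : ∀ {a b} → col a < col b → a < b
  col-cancel-< ca<cb = ≰⇒> (λ b≤a → <⇒≱ ca<cb (col-mono b≤a))

  col-< : ∀ {a b} → col b ≡ suc (col a) → a < b
  col-< eq = col-cancel-< (≤-reflexive (sym eq))

  infix 4 _~_
  _~_ : ℕ → ℕ → Set
  _~_ = Adjacent f

  ~-sym : ∀ {a b} → a ~ b → b ~ a
  ~-sym = swap

  ~-irrefl : ∀ {a b} → a ~ b → a ≢ b
  ~-irrefl (inj₁ (a<b , _)) refl = <-irrefl refl a<b
  ~-irrefl (inj₂ (b<a , _)) refl = <-irrefl refl b<a

  private
    same-< : ∀ {a b} → col a ≡ col b → b < f a
    same-< {a} {b} eq = <-≤-trans (<-start-col b)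
      (subst (λ i → f (start i) ≤ f a) eq (f-mono (start-col a)))

  same⇒~ : ∀ {a b} → col a ≡ col b → a ≢ b → a ~ b
  same⇒~ {a} {b} eq a≢b with <-cmp a b
  ... | tri< a<b _ _ = inj₁ (a<b , same-< eq)
  ... | tri≈ _ a≡b _ = contradiction a≡b a≢b
  ... | tri> _ _ b<a = inj₂ (b<a , same-< (sym eq))

  next⇒~ : ∀ {a b} → col b ≡ suc (col a) → b < f a → a ~ b
  next⇒~ eq b<fa = inj₁ (col-< eq , b<fa)

  -- The ways in which two adjacent positions can be placed: in the same column,
  -- or in neighbouring columns with the later one below the image of the earlier.
  data Near (a b : ℕ) : Set where
    same : col a ≡ col b → Near a b
    next : col b ≡ suc (col a) → b < f a → Near a b
    prev : col a ≡ suc (col b) → a < f b → Near a b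

  private
    gap : ∀ {a b} → a < b → b < f a → col a ≡ col b ⊎ col b ≡ suc (col a)
    gap {a} {b} a<b b<fa with m≤n⇒m<n∨m≡n (col-mono (<⇒≤ a<b))
    ... | inj₂ eq = inj₁ eq
    ... | inj₁ lt = inj₂ (≤-antisym (≤-pred (start-cancel-<
            (≤-<-trans (start-col b) (<-≤-trans b<fa (f-mono (<⇒≤ (<-start-col a))))))) lt)

  ~⇒near : ∀ {a b} → a ~ b → Near a b
  ~⇒near (inj₁ (a<b , b<fa)) with gap a<b b<fa
  ... | inj₁ eq = same eq
  ... | inj₂ eq = next eq b<fa
  ~⇒near (inj₂ (b<a , a<fb)) with gap b<a a<fb
  ... | inj₁ eq = same (sym eq)
  ... | inj₂ eq = prev eq a<fb

  infix 4 _⊑_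
  -- The row order.  To compare vertices of different columns, the one in the
  -- earlier column is moved by f into the column of the other; when its image
  -- meets the other vertex, it comes first.
  data _⊑_ (u v : ℕ) : Set where
    down : ∀ d → col v ≡ d + col u → F d u ≤ v → u ⊑ v
    up   : ∀ d → col u ≡ suc d + col v → u < F (suc d) v → u ⊑ v

  private
    -- If the image of u in the column of v is beyond v, then v ⊑ u.
    compare : ∀ u v d → col v ≡ d + col u → u ⊑ v ⊎ v ⊑ u
    compare u v d eq with F d u ≤? v
    ... | yes p = inj₁ (down d eq p)
    compare u v zero    eq | no p = inj₂ (down 0 (sym eq) (≰⇒≥ p))
    compare u v (suc d) eq | no p = inj₂ (up d eq (≰⇒> p))

  ⊑-total : ∀ u v → u ⊑ v ⊎ v ⊑ u
  ⊑-total u v with ≤-total (col u) (col v)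
  ... | inj₁ le = compare u v (col v ∸ col u) (sym (m∸n+n≡m le))
  ... | inj₂ le = swap (compare v u (col u ∸ col v) (sym (m∸n+n≡m le)))

  ⊑-trans : ∀ {u v w} → u ⊑ v → v ⊑ w → u ⊑ w
  ⊑-trans {u} {v} {w} (down d eq p) (down e eq′ q) =
    down (e + d) (trans eq′ (trans (cong (e +_) eq) (sym (+-assoc e d _))))
      (≤-trans (≤-reflexive (F-+ e d u)) (≤-trans (F-mono e p) q))
  ⊑-trans {u} {v} {w} (up d eq p) (up e eq′ q) =
    up (d + suc e) (trans eq (cong suc (trans (cong (d +_) eq′) (sym (+-assoc d (suc e) _)))))
      (<-≤-trans p (≤-trans (F-mono (suc d) (<⇒≤ q)) (≤-reflexive (sym (F-+ (suc d) (suc e) w)))))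
  ⊑-trans {u} {v} {w} (down d eq p) (up e eq′ q) with ≤-total (suc e) d
  ... | inj₁ e<d = down r
          (+-cancelˡ-≡ (suc e) _ _ (trans (sym eq′) (trans eq
            (trans (cong (_+ col u) (sym d≡)) (+-assoc (suc e) r _)))))
          (<⇒≤ (F-cancel-< (suc e) (≤-<-trans (≤-reflexive (trans (sym (F-+ (suc e) r u))
            (cong (λ k → F k u) d≡))) (≤-<-trans p q))))
    where
    r = d ∸ suc e
    d≡ : suc e + r ≡ d
    d≡ = m+[n∸m]≡n e<d
  ... | inj₂ d≤e with m≤n⇒m<n∨m≡n d≤e
  ...   | inj₂ refl = down 0 (+-cancelˡ-≡ (suc e) _ _ (trans (sym eq′) eq))
                        (<⇒≤ (F-cancel-< (suc e) (≤-<-trans p q)))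
  ...   | inj₁ d<e = up r
          (+-cancelˡ-≡ d _ _ (trans (sym eq) (trans eq′
            (trans (cong (_+ col w) (sym e≡)) (+-assoc d (suc r) _)))))
          (F-cancel-< d (≤-<-trans p (<-≤-trans q (≤-reflexive (trans
            (cong (λ k → F k w) (sym e≡)) (F-+ d (suc r) w))))))
    where
    r = e ∸ d
    e≡ : d + suc r ≡ suc e
    e≡ = trans (+-suc d r) (cong suc (m+[n∸m]≡n (≤-pred d<e)))
  ⊑-trans {u} {v} {w} (up d eq p) (down e eq′ q) with ≤-total (suc d) e
  ... | inj₁ d<e = down r
          (trans eq′ (trans (cong (_+ col v) (sym e≡)) (trans (+-assoc r (suc d) _) (cong (r +_) (sym eq)))))
          (≤-trans (F-mono r (<⇒≤ p)) (≤-trans (≤-reflexive (trans (sym (F-+ r (suc d) v))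
            (cong (λ k → F k v) e≡))) q))
    where
    r = e ∸ suc d
    e≡ : r + suc d ≡ e
    e≡ = m∸n+n≡m d<e
  ... | inj₂ e≤d with m≤n⇒m<n∨m≡n e≤d
  ...   | inj₂ refl = down 0 (trans eq′ (sym eq)) (<⇒≤ (<-≤-trans p q))
  ...   | inj₁ e<d = up r
          (trans eq (trans (cong (_+ col v) (sym d≡)) (trans (+-assoc (suc r) e _) (cong (suc r +_) (sym eq′)))))
          (<-≤-trans p (≤-trans (≤-reflexive (trans (cong (λ k → F k v) (sym d≡)) (F-+ (suc r) e v)))
            (F-mono (suc r) q)))
    where
    r = d ∸ e
    d≡ : suc r + e ≡ suc d
    d≡ = cong suc (m∸n+n≡m (≤-pred e<d))

  private
    n≢suc+n : ∀ d {n} → n ≢ suc d + n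
    n≢suc+n d eq = m≢1+n+m _ eq

  -- The row order decides adjacency between neighbouring columns: ⊑-next gives
  -- a non-adjacent pair, ⊑-prev an adjacent one.
  ⊑-next : ∀ {u v} → col v ≡ suc (col u) → u ⊑ v → f u ≤ v
  ⊑-next {u} {v} eq (down d eq′ p)
    with refl ← +-cancelʳ-≡ (col u) d 1 (trans (sym eq′) eq) = p
  ⊑-next {u} {v} eq (up d eq′ p) =
    contradiction (trans eq′ (trans (cong (suc d +_) eq) (+-suc (suc d) (col u)))) (n≢suc+n (suc d))

  ⊑-prev : ∀ {u v} → col u ≡ suc (col v) → u ⊑ v → u < f v
  ⊑-prev {u} {v} eq (up d eq′ p)
    with refl ← +-cancelʳ-≡ (col v) (suc d) 1 (trans (sym eq′) eq) = p
  ⊑-prev {u} {v} eq (down d eq′ p) =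
    contradiction (trans eq′ (trans (cong (d +_) eq) (+-suc d (col v)))) (n≢suc+n d)

------------------------------------------------------------------------
-- Windows of columns and bounded cuts

-- Number of colours of the cuts below when windows have at most h jumps: two
-- bits, an offset and a count of jumps, the latter two below 2 + h.
palette : ℕ → ℕ
palette h = 2 * (2 * ((2 + h) * (2 + h)))

module Windows (f : ℕ → ℕ)
               (f-mono : ∀ {a b} → a ≤ b → f a ≤ f b)
               (f-infl : ∀ a → a < f a)
               (h : ℕ) where

  open Columns f f-mono f-infl

  -- K is the number of columns in a window, and m the number of steps from its
  -- first to its last column.  They satisfy K ≥ 2, so that the first and the
  -- last column of a window differ.
  m K : ℕ
  m = suc h
  K = suc m

  -- The trajectories of t and suc t stay apart for m steps.
  Jump : ℕ → Set
  Jump t = F m t < F m (suc t)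

  jump? : ∀ t → Dec (Jump t)
  jump? t = F m t <? F m (suc t)

  -- The number of jumps below t.
  jumps : ℕ → ℕ
  jumps zero    = 0
  jumps (suc t) with jump? t
  ... | yes _ = suc (jumps t)
  ... | no  _ = jumps t

  jumps-step : ∀ t → jumps t ≤ jumps (suc t)
  jumps-step t with jump? t
  ... | yes _ = n≤1+n _
  ... | no  _ = ≤-refl

  jumps-Jump : ∀ {t} → Jump t → jumps t < jumps (suc t)
  jumps-Jump {t} J with jump? t
  ... | yes _ = ≤-refl
  ... | no ¬J = contradiction J ¬J

  jumps-increase : ∀ {t} → jumps t < jumps (suc t) → Jump t × jumps (suc t) ≡ suc (jumps t)
  jumps-increase {t} lt with jump? t
  ... | yes J = J , refl
  ... | no  _ = contradiction lt (<-irrefl refl)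

  jumps-mono : ∀ {s t} → s ≤ t → jumps s ≤ jumps t
  jumps-mono {s} {t} s≤t = subst (λ k → jumps s ≤ jumps k) (m∸n+n≡m s≤t) (go (t ∸ s))
    where
    go : ∀ d → jumps s ≤ jumps (d + s)
    go zero    = ≤-refl
    go (suc d) = ≤-trans (go d) (jumps-step (d + s))

  jumps-cancel-< : ∀ {s t} → jumps s < jumps t → s < t
  jumps-cancel-< lt = ≰⇒> (λ t≤s → <⇒≱ lt (jumps-mono t≤s))

  jumps-strict : ∀ {s t} → Jump s → s < t → jumps s < jumps t
  jumps-strict J s<t = <-≤-trans (jumps-Jump J) (jumps-mono s<t)

  -- The window of column c and its offset from the first column of that window.
  record Place (c : ℕ) : Set where
    constructor place
    field
      window offset : ℕ
      offset≤m      : offset ≤ m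
      place≡        : c ≡ offset + window * K

  next-place : ∀ {c} → Place c → Place (suc c)
  next-place (place w i i≤m c≡) with i ≟ m
  ... | yes i≡m = place (suc w) 0 z≤n (cong suc (trans c≡ (cong (_+ w * K) i≡m)))
  ... | no  i≢m  = place w (suc i) (≤∧≢⇒< i≤m i≢m) (cong suc c≡)

  -- Division with remainder by K, one column at a time so that next-locate holds
  -- by computation.
  locate : ∀ c → Place c
  locate zero    = place 0 0 z≤n refl
  locate (suc c) = next-place (locate c)

  -- The window of v, the offset of the column of v in it, and the ends of the
  -- first column of that window: base v is its first vertex and top v is the
  -- first vertex after it.
  window offset base top : ℕ → ℕ
  window v = Place.window (locate (col v))
  offset v = Place.offset (locate (col v))
  base   v = start (window v * K)
  top    v = start (suc (window v * K))

  offset≤m : ∀ v → offset v ≤ m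
  offset≤m v = Place.offset≤m (locate (col v))

  next-locate : ∀ c →
    (Place.window (locate (suc c)) ≡ Place.window (locate c) ×
     Place.offset (locate (suc c)) ≡ suc (Place.offset (locate c))) ⊎
    (Place.window (locate (suc c)) ≡ suc (Place.window (locate c)) ×
     Place.offset (locate c) ≡ m × Place.offset (locate (suc c)) ≡ 0)
  next-locate c with Place.offset (locate c) ≟ m
  ... | yes i≡m = inj₂ (refl , i≡m , refl)
  ... | no  _    = inj₁ (refl , refl)

  next-column : ∀ {a b} → col b ≡ suc (col a) →
    (window b ≡ window a × offset b ≡ suc (offset a)) ⊎
    (window b ≡ suc (window a) × offset a ≡ m × offset b ≡ 0)
  next-column {a} eq rewrite eq = next-locate (col a)

  start-shift : ∀ w i → start (i + w * K) ≡ F i (start (w * K))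
  start-shift w i = F-+ i (w * K) 0

  base≤top : ∀ v → base v ≤ top v
  base≤top v = <⇒≤ (f-infl (base v))

  F-base≤ : ∀ v → F (offset v) (base v) ≤ v
  F-base≤ v = ≤-trans
    (≤-reflexive (trans (sym (F-+ (offset v) (window v * K) 0))
      (cong start (sym (Place.place≡ (locate (col v)))))))
    (start-col v)

  <F-top : ∀ v → v < F (offset v) (top v)
  <F-top v = <-≤-trans (<-start-col v) (≤-reflexive
    (trans (cong start (trans (cong suc (Place.place≡ (locate (col v)))) (sym (+-suc (offset v) _))))
           (F-+ (offset v) (suc (window v * K)) 0)))

  private
    abstract
      ancestor : ∀ v → ∃[ t ] base v ≤ t × t < top v ∸ base v + base v ×
                       F (offset v) t ≤ v × v < F (offset v) (suc t)
      ancestor v = crossing (F (offset v)) (top v ∸ base v) (base v) (F-base≤ v)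
        (subst (λ k → v < F (offset v) k) (sym (m∸n+n≡m (base≤top v))) (<F-top v))

  -- The vertex τ v of the first column of the window of v for which v lies in
  -- the half-open interval from the image of τ v to that of suc (τ v).
  τ : ℕ → ℕ
  τ v = proj₁ (ancestor v)

  base≤τ : ∀ v → base v ≤ τ v
  base≤τ v = proj₁ (proj₂ (ancestor v))

  τ<top : ∀ v → τ v < top v
  τ<top v = <-≤-trans (proj₁ (proj₂ (proj₂ (ancestor v)))) (≤-reflexive (m∸n+n≡m (base≤top v)))

  F-τ≤ : ∀ v → F (offset v) (τ v) ≤ v
  F-τ≤ v = proj₁ (proj₂ (proj₂ (proj₂ (ancestor v))))

  <F-suc-τ : ∀ v → v < F (offset v) (suc (τ v))
  <F-suc-τ v = proj₂ (proj₂ (proj₂ (proj₂ (ancestor v))))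

  -- The vertices right of the cut in their window.  All others are left of it;
  -- in particular the whole first column is.
  Right : ℕ → Set
  Right v = 0 < offset v × Jump (τ v)

  right? : ∀ v → Dec (Right v)
  right? v = (0 <? offset v) ×-dec jump? (τ v)

  -- The right vertices of a window and the left vertices of the next share a
  -- block.
  block : ℕ → ℕ
  block v with right? v
  ... | yes _ = suc (window v)
  ... | no  _ = window v

  block-right : ∀ {v} → Right v → block v ≡ suc (window v)
  block-right {v} r with right? v
  ... | yes _ = refl
  ... | no ¬r = contradiction r ¬r

  block-left : ∀ {v} → ¬ Right v → block v ≡ window v
  block-left {v} ¬r with right? v
  ... | yes r = contradiction r ¬r
  ... | no  _ = refl

  window≤block : ∀ v → window v ≤ block v
  window≤block v with right? v
  ... | yes _ = n≤1+n _
  ... | no  _ = ≤-refl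

  block≤1+window : ∀ v → block v ≤ suc (window v)
  block≤1+window v with right? v
  ... | yes _ = ≤-refl
  ... | no  _ = n≤1+n _

  -- In the last column v itself separates the images of τ v and suc (τ v), so
  -- that τ v is a jump.
  last-right : ∀ {v} → offset v ≡ m → Right v
  last-right {v} eq = subst (0 <_) (sym eq) (s≤s z≤n) ,
    ≤-<-trans (subst (λ i → F i (τ v) ≤ v) eq (F-τ≤ v))
      (subst (λ i → v < F i (suc (τ v))) eq (<F-suc-τ v))

  first-left : ∀ {v} → offset v ≡ 0 → ¬ Right v
  first-left eq (0<i , _) = <⇒≢ 0<i (sym eq)

  across-block : ∀ {a b} → window b ≡ suc (window a) → offset a ≡ m → offset b ≡ 0 → block a ≡ block b
  across-block {a} {b} w≡ a-last b-first = trans (block-right {a} (last-right a-last))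
    (trans (sym w≡) (sym (block-left {b} (first-left b-first))))

  split-blocks : ∀ {x z} → window x ≡ window z → block x < block z → ¬ Right x × Right z
  split-blocks {x} {z} w≡ lt with right? x | right? z
  ... | yes _ | yes _ = contradiction lt (<-irrefl (cong suc w≡))
  ... | yes _ | no  _ = contradiction lt (<-asym (s≤s (≤-reflexive (sym w≡))))
  ... | no ¬x | yes z = ¬x , z
  ... | no  _ | no  _ = contradiction lt (<-irrefl w≡)

  -- For a left vertex x and a right vertex z in neighbouring columns of the same
  -- window, the numbers of jumps below τ x and τ z determine whether x and z are
  -- adjacent.  The point is that τ z is a jump while τ x is not, unless x is in
  -- the first column, where x is τ x.
  next⇒jumps : ∀ {x z} → ¬ Right x → Right z → offset z ≡ suc (offset x) →
               z < f x → jumps (τ z) < jumps (τ x)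
  next⇒jumps {x} {z} ¬x (_ , J) eq z<fx = jumps-strict J (≤∧≢⇒< τz≤τx τz≢τx)
    where
    Fτz≤z : F (suc (offset x)) (τ z) ≤ z
    Fτz≤z = subst (λ i → F i (τ z) ≤ z) eq (F-τ≤ z)

    τz≤τx : τ z ≤ τ x
    τz≤τx = ≤-pred (F-cancel-< (suc (offset x))
      (≤-<-trans Fτz≤z (<-≤-trans z<fx (f-mono (<⇒≤ (<F-suc-τ x))))))

    τz≢τx : τ z ≢ τ x
    τz≢τx τ≡ with m≤n⇒m<n∨m≡n (z≤n {offset x})
    ... | inj₁ 0<i = ¬x (0<i , subst Jump τ≡ J)
    ... | inj₂ 0≡i = <⇒≱ z<fx (≤-trans (f-mono (≤-trans x≤τx (≤-reflexive (sym τ≡))))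
                       (subst (λ i → F (suc i) (τ z) ≤ z) (sym 0≡i) Fτz≤z))
      where
      x≤τx : x ≤ τ x
      x≤τx = ≤-pred (subst (λ i → x < F i (suc (τ x))) (sym 0≡i) (<F-suc-τ x))

  jumps⇒next : ∀ {x z} → offset z ≡ suc (offset x) → jumps (τ z) < jumps (τ x) → z < f x
  jumps⇒next {x} {z} eq lt = <-≤-trans (subst (λ i → z < F i (suc (τ z))) eq (<F-suc-τ z))
    (≤-trans (F-mono (suc (offset x)) (jumps-cancel-< lt)) (f-mono (F-τ≤ x)))

  prev⇒jumps : ∀ {x z} → offset x ≡ suc (offset z) → x < f z → jumps (τ x) ≤ jumps (τ z)
  prev⇒jumps {x} {z} eq x<fz = jumps-mono (≤-pred (F-cancel-< (suc (offset z))
    (≤-<-trans (subst (λ i → F i (τ x) ≤ x) eq (F-τ≤ x)) (<-≤-trans x<fz (f-mono (<⇒≤ (<F-suc-τ z)))))))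

  jumps⇒prev : ∀ {x z} → ¬ Right x → Right z → offset x ≡ suc (offset z) →
               jumps (τ x) ≤ jumps (τ z) → x < f z
  jumps⇒prev {x} {z} ¬x (_ , J) eq le = <-≤-trans (subst (λ i → x < F i (suc (τ x))) eq (<F-suc-τ x))
    (≤-trans (F-mono (suc (offset z)) τx<τz) (f-mono (F-τ≤ z)))
    where
    τx<τz : τ x < τ z
    τx<τz = ≤∧≢⇒< (≮⇒≥ (λ lt → <⇒≱ (jumps-strict J lt) le))
      (λ τ≡ → ¬x (subst (0 <_) (sym eq) (s≤s z≤n) , subst Jump (sym τ≡) J))

  infix 4 _≲_
  -- The elimination order: by block, and by row within a block.
  _≲_ : ℕ → ℕ → Set
  x ≲ z = block x < block z ⊎ (block x ≡ block z × x ⊑ z)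

  ≲-block : ∀ {x z} → x ≲ z → block x ≤ block z
  ≲-block (inj₁ lt)       = <⇒≤ lt
  ≲-block (inj₂ (eq , _)) = ≤-reflexive eq

  ≲-⊑ : ∀ {x z} → block x ≡ block z → x ≲ z → x ⊑ z
  ≲-⊑ eq (inj₁ lt)      = contradiction lt (<-irrefl eq)
  ≲-⊑ eq (inj₂ (_ , p)) = p

  ≲-total : ∀ x z → x ≲ z ⊎ z ≲ x
  ≲-total x z with <-cmp (block x) (block z)
  ... | tri< lt _ _ = inj₁ (inj₁ lt)
  ... | tri> _ _ lt = inj₂ (inj₁ lt)
  ... | tri≈ _ eq _ with ⊑-total x z
  ...   | inj₁ p = inj₁ (inj₂ (eq , p))
  ...   | inj₂ p = inj₂ (inj₂ (sym eq , p))

  ≲-trans : ∀ {x y z} → x ≲ y → y ≲ z → x ≲ z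
  ≲-trans (inj₁ p) y≲z = inj₁ (<-≤-trans p (≲-block y≲z))
  ≲-trans x≲y@(inj₂ _) (inj₁ q) = inj₁ (≤-<-trans (≲-block x≲y) q)
  ≲-trans (inj₂ (eq , p)) (inj₂ (eq′ , q)) = inj₂ (trans eq eq′ , ⊑-trans p q)

  -- An edge between two windows joins a last to a first column, hence stays
  -- within a block.
  ~-same-window : ∀ {x z} → x ~ z → block x < block z → window x ≡ window z
  ~-same-window {x} {z} x~z lt with ~⇒near x~z
  ... | same eq = cong (λ c → Place.window (locate c)) eq
  ... | next eq _ with next-column {x} {z} eq
  ...   | inj₁ (w≡ , _) = sym w≡
  ...   | inj₂ (w≡ , l , o) = contradiction lt (<-irrefl (across-block w≡ l o))
  ~-same-window {x} {z} x~z lt | prev eq _ with next-column {z} {x} eq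
  ...   | inj₁ (w≡ , _) = w≡
  ...   | inj₂ (w≡ , l , o) = contradiction lt (<-irrefl (sym (across-block w≡ l o)))

  -- Earlier vertices x and x′ of the same column and block, with equally many
  -- jumps below τ, have the same later neighbours: within the block of x the row
  -- order decides adjacency, and in a later block next⇒jumps and its companions
  -- do.
  twins : ∀ {x x′ z} → col x ≡ col x′ → block x ≡ block x′ → jumps (τ x) ≡ jumps (τ x′) →
          x ≲ z → x′ ≲ z → x′ ≢ z → x ~ z → x′ ~ z
  twins {x} {x′} {z} c≡ b≡ j≡ x≲z x′≲z x′≢z x~z with ~⇒near x~z
  ... | same eq = same⇒~ (trans (sym c≡) eq) x′≢z
  ... | next eq z<fx = next⇒~ (trans eq (cong suc c≡)) (go x≲z)
    where
    go : x ≲ z → z < f x′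
    go (inj₂ (_ , p)) = contradiction (⊑-next eq p) (<⇒≱ z<fx)
    go (inj₁ lt) with next-column {x} {z} eq | split-blocks {x} {z} (~-same-window x~z lt) lt
    ... | inj₂ (w≡ , l , o) | _ = contradiction lt (<-irrefl (across-block w≡ l o))
    ... | inj₁ (_ , o≡) | ¬x , z-right =
      jumps⇒next (trans o≡ (cong (λ c → suc (Place.offset (locate c))) c≡))
        (subst (jumps (τ z) <_) j≡ (next⇒jumps ¬x z-right o≡ z<fx))
  ... | prev eq x<fz = ~-sym (next⇒~ (trans (sym c≡) eq) (go x≲z))
    where
    go : x ≲ z → x′ < f z
    go (inj₂ (b , _)) = ⊑-prev (trans (sym c≡) eq) (≲-⊑ (trans (sym b≡) b) x′≲z)
    go (inj₁ lt) with next-column {z} {x} eq | ~-same-window x~z lt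
    ... | inj₂ (w≡ , l , o) | _ = contradiction lt (<-irrefl (sym (across-block w≡ l o)))
    ... | inj₁ (_ , o≡) | w≡ = jumps⇒prev (proj₁ ¬x′,z) (proj₂ ¬x′,z)
        (trans (cong (λ c → Place.offset (locate c)) (sym c≡)) o≡)
        (subst (_≤ jumps (τ z)) j≡ (prev⇒jumps o≡ x<fz))
      where
      ¬x′,z : ¬ Right x′ × Right z
      ¬x′,z = split-blocks (trans (cong (λ c → Place.window (locate c)) (sym c≡)) w≡)
                (subst (_< block z) b≡ lt)

  -- A vertex in a block before q with neighbours in block q or later is a left
  -- vertex of window q - 1.
  distant : ∀ {x z q} → x ~ z → block x < q → q ≤ block z → suc (window x) ≡ q
  distant {x} {z} {q} x~z x<q q≤z = ≤-antisym (≤-<-trans (window≤block x) x<q)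
    (≤-trans q≤z (subst (λ w → block z ≤ suc w)
      (sym (~-same-window x~z (<-≤-trans x<q q≤z))) (block≤1+window z)))

  -- The first column of window w contains more than h jumps.
  Dense : ℕ → Set
  Dense w = h < jumps (start (suc (w * K))) ∸ jumps (start (w * K))

  module _ (sparse : ∀ w → ¬ Dense w) where

    private
      bit : ∀ {A : Set} → Dec A → Fin 2
      bit (yes _) = Fin.suc Fin.zero
      bit (no  _) = Fin.zero

      -- The number of jumps in the first column of the window of v that are below
      -- τ v.
      level : ℕ → ℕ
      level v = jumps (τ v) ∸ jumps (base v)

      level<K : ∀ v → level v < K
      level<K v = s≤s (≤-trans (∸-monoˡ-≤ (jumps (base v)) (jumps-mono (<⇒≤ (τ<top v))))
                    (≤-trans (≮⇒≥ (sparse (window v))) (n≤1+n h)))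

      offset<K : ∀ v → offset v < K
      offset<K v = s≤s (offset≤m v)

    -- The colour of x for a cut inside or at the start of block q.  The two bits
    -- single out the vertices that can have neighbours beyond the cut, and among
    -- those they fix the window.
    colour : ℕ → ℕ → Fin (palette h)
    colour q x = combine (bit (block x ≟ q)) (combine (bit (suc (window x) ≟ q))
                   (combine (fromℕ< (offset<K x)) (fromℕ< (level<K x))))

    private
      bit-≡ : ∀ {A B : Set} (a? : Dec A) (b? : Dec B) → bit a? ≡ bit b? → A → B
      bit-≡ (yes _) (yes b) _  _ = b
      bit-≡ (no ¬a) _       _  a = contradiction a ¬a

      module _ {q x x′} (eq : colour q x ≡ colour q x′) where

        eqs = combine-injective (bit (block x ≟ q)) _ (bit (block x′ ≟ q)) _ eq
        eqs′ = combine-injective (bit (suc (window x) ≟ q)) _ (bit (suc (window x′) ≟ q)) _ (proj₂ eqs)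
        eqs″ = combine-injective (fromℕ< (offset<K x)) _ (fromℕ< (offset<K x′)) _ (proj₂ eqs′)

        block-≡ : block x ≡ q → block x′ ≡ q
        block-≡ = bit-≡ (block x ≟ q) (block x′ ≟ q) (proj₁ eqs)

        window-≡ : suc (window x) ≡ q → suc (window x′) ≡ q
        window-≡ = bit-≡ (suc (window x) ≟ q) (suc (window x′) ≟ q) (proj₁ eqs′)

        offset-≡ : offset x ≡ offset x′
        offset-≡ = Fin.fromℕ<-injective _ _ (offset<K x) (offset<K x′) (proj₁ eqs″)

        level-≡ : level x ≡ level x′
        level-≡ = Fin.fromℕ<-injective _ _ (level<K x) (level<K x′) (proj₂ eqs″)

        col-≡ : window x ≡ window x′ → col x ≡ col x′
        col-≡ w≡ = trans (Place.place≡ (locate (col x))) (trans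
          (subst₂ (λ w i → offset x + window x * K ≡ i + w * K) w≡ offset-≡ refl)
          (sym (Place.place≡ (locate (col x′)))))

        jumps-≡ : window x ≡ window x′ → jumps (τ x) ≡ jumps (τ x′)
        jumps-≡ w≡ = ∸-cancelʳ-≡ (jumps-mono (base≤τ x))
          (subst (λ w → jumps (start (w * K)) ≤ jumps (τ x′)) (sym w≡) (jumps-mono (base≤τ x′)))
          (trans level-≡ (cong (λ w → jumps (τ x′) ∸ jumps (start (w * K))) (sym w≡)))

    -- For a cut at a vertex of block q, equally coloured vertices before the cut
    -- have the same neighbours beyond it.
    colour-twins : ∀ {q x x′ z} → block x ≤ q → block x′ ≤ q → q ≤ block z → x ≲ z → x′ ≲ z → x′ ≢ z →
                   colour q x ≡ colour q x′ → x ~ z → x′ ~ z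
    colour-twins {q} {x} {x′} {z} x≤q x′≤q q≤z x≲z x′≲z x′≢z eq x~z =
      twins (col-≡ eq (proj₁ agree)) (proj₂ agree) (jumps-≡ eq (proj₁ agree)) x≲z x′≲z x′≢z x~z
      where
      -- If x is in block q, the second bit tells whether it is in window q or in
      -- window q - 1.  Otherwise its neighbour z forces window q - 1.
      cases : Dec (block x ≡ q) → Dec (suc (window x) ≡ q) → window x ≡ window x′ × block x ≡ block x′
      cases (yes b) (yes w) = suc-injective (trans w (sym (window-≡ eq w))) , trans b (sym (block-≡ eq b))
      cases (yes b) (no ¬w) = trans (behind b ¬w) (sym (behind (block-≡ eq b) (¬w ∘ window-≡ (sym eq)))) ,
                            trans b (sym (block-≡ eq b))
        where
        behind : ∀ {y} → block y ≡ q → suc (window y) ≢ q → window y ≡ q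
        behind {y} b ¬w with m≤n⇒m<n∨m≡n (window≤block y)
        ... | inj₂ w≡b = trans w≡b b
        ... | inj₁ w<b = contradiction (trans (≤-antisym w<b (block≤1+window y)) b) ¬w
      cases (no ¬b) _ = suc-injective (trans w (sym (window-≡ eq w))) ,
                        suc-injective (trans (ahead x≤q ¬b w)
                          (sym (ahead x′≤q (¬b ∘ block-≡ (sym eq)) (window-≡ eq w))))
        where
        w : suc (window x) ≡ q
        w = distant x~z (≤∧≢⇒< x≤q ¬b) q≤z

        ahead : ∀ {y} → block y ≤ q → block y ≢ q → suc (window y) ≡ q → suc (block y) ≡ q
        ahead {y} y≤q ¬b w = ≤-antisym (≤∧≢⇒< y≤q ¬b)
          (≤-trans (≤-reflexive (sym w)) (s≤s (window≤block y)))

      agree : window x ≡ window x′ × block x ≡ block x′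
      agree = cases (block x ≟ q) (suc (window x) ≟ q)

------------------------------------------------------------------------
-- Universality of grids

  -- The trajectories of the jumps in a dense window.
  module Grid (w : ℕ) (dense : Dense w) where

    private
      s e : ℕ
      s = start (w * K)
      e = start (suc (w * K))

      s≤e : s ≤ e
      s≤e = <⇒≤ (f-infl s)

    abstract
      jump : ∀ (j : Fin (suc h)) → ∃[ t ] s ≤ t × t < e × jumps t ≡ Fin.toℕ j + jumps s × Jump t
      jump j with crossing jumps (e ∸ s) s (m≤n+m (jumps s) (Fin.toℕ j))
        (subst (λ k → Fin.toℕ j + jumps s < jumps k) (sym (m∸n+n≡m s≤e))
          (<-≤-trans (+-monoˡ-< (jumps s) (<-≤-trans (Fin.toℕ<n j) dense))
            (≤-reflexive (m∸n+n≡m (jumps-mono s≤e)))))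
      ... | t , s≤t , t< , low , high with jumps-increase (≤-<-trans low high)
      ...   | J , step = t , s≤t , <-≤-trans t< (≤-reflexive (m∸n+n≡m s≤e)) ,
              ≤-antisym low (≤-pred (≤-trans high (≤-reflexive step))) , J

    -- The j-th jump in the first column of window w.
    root : Fin (suc h) → ℕ
    root j = proj₁ (jump j)

    s≤root : ∀ j → s ≤ root j
    s≤root j = proj₁ (proj₂ (jump j))

    root<e : ∀ j → root j < e
    root<e j = proj₁ (proj₂ (proj₂ (jump j)))

    jumps-root : ∀ j → jumps (root j) ≡ Fin.toℕ j + jumps s
    jumps-root j = proj₁ (proj₂ (proj₂ (proj₂ (jump j))))

    root-Jump : ∀ j → Jump (root j)
    root-Jump j = proj₂ (proj₂ (proj₂ (proj₂ (jump j))))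

    root-mono : ∀ {j k} → Fin.toℕ j < Fin.toℕ k → root j < root k
    root-mono {j} {k} j<k = jumps-cancel-< (≤-<-trans (≤-reflexive (jumps-root j))
      (<-≤-trans (+-monoˡ-< (jumps s) j<k) (≤-reflexive (sym (jumps-root k)))))

    root-cancel : ∀ {j k} → root j < root k → Fin.toℕ j < Fin.toℕ k
    root-cancel {j} {k} lt = +-cancelʳ-< (jumps s) _ _ (≤-<-trans (≤-reflexive (sym (jumps-root j)))
      (<-≤-trans (jumps-strict (root-Jump j) lt) (≤-reflexive (jumps-root k))))

    -- A jump keeps trajectories apart not only after m steps but also before.
    F-strict : ∀ {i t u} → i ≤ m → Jump t → t < u → F i t < F i u
    F-strict {i} {t} {u} i≤m J t<u = ≰⇒> λ Fu≤Ft → <⇒≱ (<-≤-trans J (F-mono m t<u))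
      (subst (λ d → F d u ≤ F d t) (m∸n+n≡m i≤m)
        (≤-trans (≤-reflexive (F-+ (m ∸ i) i u))
          (≤-trans (F-mono (m ∸ i) Fu≤Ft) (≤-reflexive (sym (F-+ (m ∸ i) i t))))))

    -- The image of the j-th jump in the column with offset i.
    node : ℕ → Fin (suc h) → ℕ
    node i j = F i (root j)

    start≤node : ∀ i j → start (i + w * K) ≤ node i j
    start≤node i j = ≤-trans (≤-reflexive (start-shift w i)) (F-mono i (s≤root j))

    node<start : ∀ {i} → i ≤ m → ∀ j → node i j < start (suc (i + w * K))
    node<start {i} i≤m j = <-≤-trans (F-strict i≤m (root-Jump j) (root<e j))
      (≤-reflexive (trans (sym (F-+ i (suc (w * K)) 0)) (cong start (+-suc i (w * K)))))

    col-node : ∀ {i} → i ≤ m → ∀ j → col (node i j) ≡ i + w * K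
    col-node {i} i≤m j = col-unique (start≤node i j) (node<start i≤m j)

    -- When a further jump follows, the trajectories of both pass through column i,
    -- which therefore contains suc (node i j).
    node-bound : ∀ {i} → i ≤ m → ∀ {j k} → Fin.toℕ j < Fin.toℕ k → suc (node i j) < f (node i j)
    node-bound {i} i≤m {j} {k} j<k = ≤-<-trans (F-strict i≤m (root-Jump j) (root-mono j<k))
      (<-≤-trans (node<start i≤m k) (f-mono (start≤node i j)))

-- The graph of g restricted to the h positions p y embeds into the graph of f
-- as soon as the latter has a dense window.
module Embedding
  (f : ℕ → ℕ) (f-mono : ∀ {a b} → a ≤ b → f a ≤ f b) (f-infl : ∀ a → a < f a)
  (g : ℕ → ℕ) (g-mono : ∀ {a b} → a ≤ b → g a ≤ g b) (g-infl : ∀ a → a < g a)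
  {h : ℕ} (p : Fin h → ℕ) (p<h : ∀ y → p y < h)
  (p-injective : ∀ {y z} → p y ≡ p z → y ≡ z)
  (rank : Fin h → Fin h) (rank-injective : ∀ {y z} → rank y ≡ rank z → y ≡ z)
  (rank-⊑ : ∀ {y z} → Fin.toℕ (rank y) < Fin.toℕ (rank z) → Columns._⊑_ g g-mono g-infl (p y) (p z))
  (w : ℕ) (dense : Windows.Dense f f-mono f-infl h w)
  where

  private
    module G = Columns f f-mono f-infl
    module H = Columns g g-mono g-infl
    module W = Windows f f-mono f-infl h
    module N = W.Grid w dense

    level : Fin h → ℕ
    level y = H.col (p y)

    level≤ : ∀ y → level y ≤ W.m
    level≤ y = ≤-trans (H.col≤ (p y)) (≤-trans (<⇒≤ (p<h y)) (n≤1+n h))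

    -- At least h + 1 jumps are available, of which the last is left unoccupied so
    -- that node-bound applies.
    row : Fin h → Fin (suc h)
    row y = Fin.inject₁ (rank y)

    rank-cmp : ∀ {y z} → y ≢ z → Fin.toℕ (rank y) < Fin.toℕ (rank z) ⊎ Fin.toℕ (rank z) < Fin.toℕ (rank y)
    rank-cmp {y} {z} y≢z with <-cmp (Fin.toℕ (rank y)) (Fin.toℕ (rank z))
    ... | tri< lt _ _ = inj₁ lt
    ... | tri≈ _ eq _ = contradiction (rank-injective (Fin.toℕ-injective eq)) y≢z
    ... | tri> _ _ lt = inj₂ lt

    row-< : ∀ {y z} → Fin.toℕ (rank y) < Fin.toℕ (rank z) → Fin.toℕ (row y) < Fin.toℕ (row z)
    row-< {y} {z} = subst₂ _<_ (sym (Fin.toℕ-inject₁ (rank y))) (sym (Fin.toℕ-inject₁ (rank z)))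

    row-<⁻¹ : ∀ {y z} → Fin.toℕ (row y) < Fin.toℕ (row z) → Fin.toℕ (rank y) < Fin.toℕ (rank z)
    row-<⁻¹ {y} {z} = subst₂ _<_ (Fin.toℕ-inject₁ (rank y)) (Fin.toℕ-inject₁ (rank z))

  -- The grid position of y is given by its column and its rank in the row order.
  embed : Fin h → ℕ
  embed y = N.node (level y) (row y)

  embed-bound : ∀ y → suc (embed y) < f (embed y)
  embed-bound y = N.node-bound (level≤ y) {k = Fin.suc (rank y)}
    (≤-reflexive (cong suc (Fin.toℕ-inject₁ (rank y))))

  private
    col-embed : ∀ y → G.col (embed y) ≡ level y + w * W.K
    col-embed y = N.col-node (level≤ y) (row y)

    level-≡ : ∀ {y z} → G.col (embed y) ≡ G.col (embed z) → level y ≡ level z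
    level-≡ {y} {z} eq = +-cancelʳ-≡ (w * W.K) _ _ (trans (sym (col-embed y)) (trans eq (col-embed z)))

    level-suc : ∀ {y z} → G.col (embed z) ≡ suc (G.col (embed y)) → level z ≡ suc (level y)
    level-suc {y} {z} eq = +-cancelʳ-≡ (w * W.K) _ _
      (trans (sym (col-embed z)) (trans eq (cong suc (col-embed y))))

    col-suc : ∀ {y z} → level z ≡ suc (level y) → G.col (embed z) ≡ suc (G.col (embed y))
    col-suc {y} {z} eq = trans (col-embed z) (trans (cong (_+ w * W.K) eq) (cong suc (sym (col-embed y))))

    embed-≢ : ∀ {y z} → level y ≡ level z → Fin.toℕ (rank y) < Fin.toℕ (rank z) → embed y ≢ embed z
    embed-≢ {y} {z} l≡ lt eq = <-irrefl eq (subst (λ l → embed y < N.node l (row z)) l≡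
      (N.F-strict (level≤ y) (N.root-Jump (row y)) (N.root-mono (row-< {y} {z} lt))))

    next⇒rank : ∀ {y z} → y ≢ z → level z ≡ suc (level y) → p z < g (p y) → embed z < f (embed y)
    next⇒rank {y} {z} y≢z l≡ lt with rank-cmp y≢z
    ... | inj₁ y<z = contradiction (H.⊑-next l≡ (rank-⊑ y<z)) (<⇒≱ lt)
    ... | inj₂ z<y = subst (λ l → N.node l (row z) < f (embed y)) (sym l≡)
      (N.F-strict (subst (_≤ W.m) l≡ (level≤ z)) (N.root-Jump (row z)) (N.root-mono (row-< {z} {y} z<y)))

    rank⇒next : ∀ {y z} → level z ≡ suc (level y) → embed z < f (embed y) → p z < g (p y)
    rank⇒next {y} {z} l≡ lt = H.⊑-prev l≡ (rank-⊑ (row-<⁻¹ {z} {y} (N.root-cancel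
      (G.F-cancel-< (suc (level y)) (subst (λ l → N.node l (row z) < f (embed y)) l≡ lt)))))

  embed-injective : ∀ {y z} → embed y ≡ embed z → y ≡ z
  embed-injective {y} {z} eq with y Fin.≟ z
  ... | yes y≡z = y≡z
  ... | no  y≢z with rank-cmp y≢z
  ...   | inj₁ lt = contradiction eq (embed-≢ (level-≡ (cong G.col eq)) lt)
  ...   | inj₂ lt = contradiction (sym eq) (embed-≢ (level-≡ (cong G.col (sym eq))) lt)

  embed-~ : ∀ {y z} → p y H.~ p z → embed y G.~ embed z
  embed-~ {y} {z} a with H.~⇒near a
  ... | H.same eq = G.same⇒~ (trans (col-embed y) (trans (cong (_+ w * W.K) eq) (sym (col-embed z))))
                      (λ e≡ → H.~-irrefl a (cong p (embed-injective e≡)))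
  ... | H.next eq lt = G.next⇒~ (col-suc {y} {z} eq) (next⇒rank (λ y≡z → H.~-irrefl a (cong p y≡z)) eq lt)
  ... | H.prev eq lt = G.~-sym (G.next⇒~ (col-suc {z} {y} eq)
                         (next⇒rank (λ z≡y → H.~-irrefl a (cong p (sym z≡y))) eq lt))

  embed-~⁻¹ : ∀ {y z} → embed y G.~ embed z → p y H.~ p z
  embed-~⁻¹ {y} {z} a with G.~⇒near a
  ... | G.same eq = H.same⇒~ (level-≡ eq) (λ p≡ → G.~-irrefl a (cong embed (p-injective p≡)))
  ... | G.next eq lt = H.next⇒~ (level-suc {y} {z} eq) (rank⇒next (level-suc {y} {z} eq) lt)
  ... | G.prev eq lt = H.~-sym (H.next⇒~ (level-suc {z} {y} eq) (rank⇒next (level-suc {z} {y} eq) lt))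

------------------------------------------------------------------------
-- Constructing labelled graphs

-- An expression whose value is the graph on V with adjacency E and labels L,
-- up to a bijection between its vertices and V.
record Construction {k} {V : Set} (E : Rel V 0ℓ) (L : V → Fin k) : Set where
  field
    expression : Expression k

  open LabelledGraph ⟦ expression ⟧ using (Vertex; _~_; label)

  field
    naming     : Vertex ↔ V
    adjacency  : ∀ u v → (u ~ v) ⇔ E (Inverse.to naming u) (Inverse.to naming v)
    labelling  : ∀ u → label u ≡ L (Inverse.to naming u)

open Construction

module _ {k} {V : Set} {L : V → Fin k} where

  redraw : ∀ {E F : Rel V 0ℓ} → (∀ u v → E u v ⇔ F u v) → Construction E L → Construction F L
  redraw E⇔F c = record
    { expression = expression c
    ; naming     = naming c
    ; adjacency  = λ u v → E⇔F _ _ ⇔-∘ adjacency c u v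
    ; labelling  = labelling c
    }

  -- A bijection π changes the names of the vertices.
  transport : ∀ {W : Set} {E : Rel V 0ℓ} (π : V ↔ W) → Construction E L →
              Construction (E on Inverse.from π) (L ∘ Inverse.from π)
  transport {W} {E} π c = record
    { expression = expression c
    ; naming     = π ↔-∘ naming c
    ; adjacency  = λ u v → subst₂ (λ x y → _ ⇔ E x y) (sym (back _)) (sym (back _)) (adjacency c u v)
    ; labelling  = λ u → trans (labelling c u) (cong L (sym (back _)))
    }
    where
    back : ∀ v → Inverse.from π (Inverse.to π v) ≡ v
    back = Inverse.strictlyInverseʳ π

  joined : ∀ {E : Rel V 0ℓ} {i j} → i ≢ j → Construction E L →
           Construction (λ u v → E u v ⊎ (L u ≡ i × L v ≡ j) ⊎ (L v ≡ i × L u ≡ j)) L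
  joined {E} {i} {j} i≢j c = record
    { expression = η i j i≢j (expression c)
    ; naming     = naming c
    ; adjacency  = λ u v → mk⇔
        (Sum.map (⇒ (adjacency c u v)) (Sum.map (fwd u v) (fwd v u)))
        (Sum.map (⇐ (adjacency c u v)) (Sum.map (bwd u v) (bwd v u)))
    ; labelling  = labelling c
    }
    where
    module X = LabelledGraph ⟦ expression c ⟧
    to = Inverse.to (naming c)

    fwd : ∀ u v → X.label u ≡ i × X.label v ≡ j → L (to u) ≡ i × L (to v) ≡ j
    fwd u v (p , q) = trans (sym (labelling c u)) p , trans (sym (labelling c v)) q

    bwd : ∀ u v → L (to u) ≡ i × L (to v) ≡ j → X.label u ≡ i × X.label v ≡ j
    bwd u v (p , q) = trans (labelling c u) p , trans (labelling c v) q

  renamed : ∀ {E : Rel V 0ℓ} i j → Construction E L →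
            Construction E (λ v → if does (L v Fin.≟ i) then j else L v)
  renamed i j c = record
    { expression = ρ i j (expression c)
    ; naming     = naming c
    ; adjacency  = adjacency c
    ; labelling  = λ u → cong (λ l → if does (l Fin.≟ i) then j else l) (labelling c u)
    }

  -- All vertices labelled i are joined to all vertices with labels in js.
  star : ∀ {E : Rel V 0ℓ} i js → ¬ i ∈ js → Construction E L →
         Construction (λ u v → E u v ⊎ (L u ≡ i × L v ∈ js) ⊎ (L v ≡ i × L u ∈ js)) L
  star i [] _ c = redraw (λ u v → mk⇔ inj₁
    λ { (inj₁ e) → e ; (inj₂ (inj₁ (_ , ()))) ; (inj₂ (inj₂ (_ , ()))) }) c
  star i (j ∷ js) i∉ c = redraw (λ u v → mk⇔ grow shrink)
    (joined (λ i≡j → i∉ (here i≡j)) (star i js (i∉ ∘ there) c))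
    where
    grow : ∀ {A : Set} {u v} →
      (A ⊎ (L u ≡ i × L v ∈ js) ⊎ (L v ≡ i × L u ∈ js)) ⊎ (L u ≡ i × L v ≡ j) ⊎ (L v ≡ i × L u ≡ j) →
      A ⊎ (L u ≡ i × L v ∈ j ∷ js) ⊎ (L v ≡ i × L u ∈ j ∷ js)
    grow (inj₁ (inj₁ e))              = inj₁ e
    grow (inj₁ (inj₂ (inj₁ (p , q)))) = inj₂ (inj₁ (p , there q))
    grow (inj₁ (inj₂ (inj₂ (p , q)))) = inj₂ (inj₂ (p , there q))
    grow (inj₂ (inj₁ (p , q)))        = inj₂ (inj₁ (p , here q))
    grow (inj₂ (inj₂ (p , q)))        = inj₂ (inj₂ (p , here q))

    shrink : ∀ {A : Set} {u v} →
      A ⊎ (L u ≡ i × L v ∈ j ∷ js) ⊎ (L v ≡ i × L u ∈ j ∷ js) →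
      (A ⊎ (L u ≡ i × L v ∈ js) ⊎ (L v ≡ i × L u ∈ js)) ⊎ (L u ≡ i × L v ≡ j) ⊎ (L v ≡ i × L u ≡ j)
    shrink (inj₁ e)                     = inj₁ (inj₁ e)
    shrink (inj₂ (inj₁ (p , here q)))   = inj₂ (inj₁ (p , q))
    shrink (inj₂ (inj₁ (p , there q)))  = inj₁ (inj₂ (inj₁ (p , q)))
    shrink (inj₂ (inj₂ (p , here q)))   = inj₂ (inj₂ (p , q))
    shrink (inj₂ (inj₂ (p , there q)))  = inj₁ (inj₂ (inj₂ (p , q)))

point : ∀ {k} (i : Fin k) → Construction {V = Fin 1} (λ _ _ → ⊥) (const i)
point i = record
  { expression = new i
  ; naming     = ↔-id _
  ; adjacency  = λ _ _ → ⇔-id _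
  ; labelling  = λ _ → refl
  }

union : ∀ {k} {V W : Set} {E : Rel V 0ℓ} {F : Rel W 0ℓ} {L : V → Fin k} {M : W → Fin k} →
        Construction E L → Construction F M → Construction (Pointwise E F) [ L , M ]′
union {V = V} {W} {E} {F} {L} {M} c d = record
  { expression = expression c ⊕ expression d
  ; naming     = (naming c ⊎-↔ naming d) ↔-∘ +↔⊎
  ; adjacency  = λ u v → adj (splitAt C.order u) (splitAt C.order v)
  ; labelling  = λ u → lab (splitAt C.order u)
  }
  where
  module C = LabelledGraph ⟦ expression c ⟧
  module D = LabelledGraph ⟦ expression d ⟧
  to : C.Vertex ⊎ D.Vertex → V ⊎ W
  to = Sum.map (Inverse.to (naming c)) (Inverse.to (naming d))

  adj : ∀ u v → Pointwise C._~_ D._~_ u v ⇔ Pointwise E F (to u) (to v)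
  adj (inj₁ u) (inj₁ v) = mk⇔ (λ { (inj₁ e) → inj₁ (⇒ (adjacency c u v) e) })
                              (λ { (inj₁ e) → inj₁ (⇐ (adjacency c u v) e) })
  adj (inj₂ u) (inj₂ v) = mk⇔ (λ { (inj₂ e) → inj₂ (⇒ (adjacency d u v) e) })
                              (λ { (inj₂ e) → inj₂ (⇐ (adjacency d u v) e) })
  adj (inj₁ u) (inj₂ v) = mk⇔ (λ ()) (λ ())
  adj (inj₂ u) (inj₁ v) = mk⇔ (λ ()) (λ ())

  lab : ∀ u → [ C.label , D.label ]′ u ≡ [ L , M ]′ (to u)
  lab (inj₁ u) = labelling c u
  lab (inj₂ v) = labelling d v

realises : ∀ {k} G {V : Set} {E : Rel V 0ℓ} {L : V → Fin k} → Construction E L →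
           (π : V ↔ Graph.Vertex G) →
           (∀ u v → E u v ⇔ Graph._~_ G (Inverse.to π u) (Inverse.to π v)) → ConstructibleWith k G
realises G c π E⇔~ = inj₂ (expression c , π ↔-∘ naming c , λ u v → E⇔~ _ _ ⇔-∘ adjacency c u v)

------------------------------------------------------------------------
-- Clique-width from vertex orders with bounded cuts

-- Vertices 0, 1, …, n - 1 with adjacency A, ordered so that for each t the
-- vertices below t with the same colour c t have the same neighbours among the
-- vertices from t on.  The vertices are added one at a time, using one label
-- more than there are colours.
module Sweep
  {k n : ℕ} (A : Rel ℕ 0ℓ) (A? : Decidable A) (A-sym : Symmetric A) (A-irr : ∀ {x} → ¬ A x x)
  (c : ℕ → ℕ → Fin (suc k))
  (twins : ∀ {t x y z} → x < t → y < t → t ≤ z → z < n → c t x ≡ c t y → A x z → A y z)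
  where

  -- The subgraph induced on the first t vertices.
  on-Fin : ∀ t → Rel (Fin t) 0ℓ
  on-Fin t u v = A (Fin.toℕ u) (Fin.toℕ v)

  -- Vertices with equal labels have the same neighbours among those still to be
  -- added.
  Faithful : ∀ {t} → (Fin t → Fin (2 + k)) → Set
  Faithful {t} L = ∀ {u v z} → L u ≡ L v → t ≤ z → z < n → A (Fin.toℕ u) z → A (Fin.toℕ v) z

  -- A construction of the first t vertices with one label kept free for the next
  -- vertex.
  record Stage (t : ℕ) : Set where
    field
      label        : Fin t → Fin (2 + k)
      construction : Construction (on-Fin t) label
      faithful     : Faithful label
      spare        : Fin (2 + k)
      unused       : ∀ u → label u ≢ spare

  first : Stage 1
  first = record
    { label        = const Fin.zero
    ; construction = redraw (λ { Fin.zero Fin.zero → mk⇔ (λ ()) A-irr }) (point Fin.zero)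
    ; faithful     = λ { {Fin.zero} {Fin.zero} _ _ _ a → a }
    ; spare        = Fin.suc Fin.zero
    ; unused       = λ _ ()
    }

  module _ {t} (L : Fin t → Fin (2 + k)) (con : Construction (on-Fin t) L)
           (L-faithful : Faithful L) where

    -- One label can always be freed: if all 2 + k labels are in use, then two of
    -- them carry vertices of the same colour, and these two labels can be merged.
    free-label : Stage t
    free-label with any? (λ l → all? (λ u → ¬? (L u Fin.≟ l)))
    ... | yes (l , unused) = record
      { label = L ; construction = con ; faithful = L-faithful ; spare = l ; unused = unused }
    ... | no all-used = merge (pigeonhole ≤-refl (c t ∘ Fin.toℕ ∘ user))
      where
      used : ∀ l → ∃[ u ] L u ≡ l
      used l with any? (λ u → L u Fin.≟ l)
      ... | yes u  = u
      ... | no  ¬u = contradiction (l , λ u eq → ¬u (u , eq)) all-used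

      -- A vertex representing each label.
      user : Fin (2 + k) → Fin t
      user l = proj₁ (used l)

      -- Renaming i to j keeps the labels faithful, because the vertices representing
      -- i and j are twins with respect to the remaining vertices.
      merge : (∃[ i ] ∃[ j ] i Fin.< j × c t (Fin.toℕ (user i)) ≡ c t (Fin.toℕ (user j))) → Stage t
      merge (i , j , i<j , same) = record
        { label        = M
        ; construction = renamed i j con
        ; faithful     = λ {u} {v} → M-faithful u v
        ; spare        = i
        ; unused       = M≢i
        }
        where
        i≢j : i ≢ j
        i≢j refl = <-irrefl refl i<j

        M : Fin t → Fin (2 + k)
        M u = if does (L u Fin.≟ i) then j else L u

        M≢i : ∀ u → M u ≢ i
        M≢i u with L u Fin.≟ i
        ... | yes _ = i≢j ∘ sym
        ... | no  p = p

        twin : ∀ {i j u v z} → c t (Fin.toℕ (user i)) ≡ c t (Fin.toℕ (user j)) → L u ≡ i → L v ≡ j →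
               t ≤ z → z < n → A (Fin.toℕ u) z → A (Fin.toℕ v) z
        twin {i} {j} eq u≡i v≡j t≤z z<n a = L-faithful (trans (proj₂ (used j)) (sym v≡j)) t≤z z<n
          (twins (Fin.toℕ<n (user i)) (Fin.toℕ<n (user j)) t≤z z<n eq
            (L-faithful (trans u≡i (sym (proj₂ (used i)))) t≤z z<n a))

        M-faithful : ∀ u v {z} → M u ≡ M v → t ≤ z → z < n → A (Fin.toℕ u) z → A (Fin.toℕ v) z
        M-faithful u v eq with L u Fin.≟ i | L v Fin.≟ i
        ... | yes p | yes q = L-faithful (trans p (sym q))
        ... | yes p | no  _ = twin same p (sym eq)
        ... | no  _ | yes q = twin (sym same) eq q
        ... | no  _ | no  _ = L-faithful eq

  -- The new vertex receives the spare label and is joined to the labels of its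
  -- neighbours, which by faithfulness occur on neighbours only.
  step : ∀ {t} → t < n → Stage t → Stage (t + 1)
  step {t} t<n stage = free-label M construction′ M-faithful
    where
    open Stage stage renaming (label to L; spare to i)

    neighbours : List (Fin t)
    neighbours = filter (λ u → A? (Fin.toℕ u) t) (allFin t)

    N : Fin t ⊎ Fin 1 → Fin (2 + k)
    N = [ L , const i ]′

    targets : List (Fin (2 + k))
    targets = map L neighbours

    i∉targets : ¬ i ∈ targets
    i∉targets p with ∈-map⁻ L p
    ... | u , _ , i≡Lu = unused u (sym i≡Lu)

    ~⇒target : ∀ {u} → A (Fin.toℕ u) t → L u ∈ targets
    ~⇒target a = ∈-map⁺ L (∈-filter⁺ (λ u → A? (Fin.toℕ u) t) (∈-allFin _) a)

    target⇒~ : ∀ {u} → L u ∈ targets → A (Fin.toℕ u) t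
    target⇒~ p with ∈-map⁻ L p
    ... | v , v∈ , Lu≡Lv = faithful (sym Lu≡Lv) ≤-refl t<n
                             (proj₂ (∈-filter⁻ (λ u → A? (Fin.toℕ u) t) {xs = allFin t} v∈))

    -- The new vertex is at position t.
    position : Fin t ⊎ Fin 1 → ℕ
    position = [ Fin.toℕ , const t ]′

    -- Joining the spare label to the targets creates exactly the edges at the new
    -- vertex t.
    drawn : ∀ u v → (Pointwise (on-Fin t) (λ _ _ → ⊥) u v ⊎
                     (N u ≡ i × N v ∈ targets) ⊎ (N v ≡ i × N u ∈ targets)) ⇔
                    A (position u) (position v)
    drawn (inj₁ u) (inj₁ v) = mk⇔
      (λ { (inj₁ (inj₁ a)) → a
         ; (inj₂ (inj₁ (p , _))) → contradiction p (unused u)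
         ; (inj₂ (inj₂ (p , _))) → contradiction p (unused v) })
      (λ a → inj₁ (inj₁ a))
    drawn (inj₁ u) (inj₂ _) = mk⇔
      (λ { (inj₂ (inj₁ (p , _))) → contradiction p (unused u)
         ; (inj₂ (inj₂ (_ , p))) → target⇒~ p })
      (λ a → inj₂ (inj₂ (refl , ~⇒target a)))
    drawn (inj₂ _) (inj₁ v) = mk⇔
      (λ { (inj₂ (inj₁ (_ , p))) → A-sym (target⇒~ p)
         ; (inj₂ (inj₂ (p , _))) → contradiction p (unused v) })
      (λ a → inj₂ (inj₁ (refl , ~⇒target (A-sym a))))
    drawn (inj₂ _) (inj₂ _) = mk⇔
      (λ { (inj₁ (inj₂ ()))
         ; (inj₂ (inj₁ (_ , p))) → contradiction p i∉targets
         ; (inj₂ (inj₂ (_ , p))) → contradiction p i∉targets })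
      (λ a → contradiction a A-irr)

    M : Fin (t + 1) → Fin (2 + k)
    M = N ∘ splitAt t

    position-split : ∀ u → position (splitAt t u) ≡ Fin.toℕ u
    position-split u with splitAt t u in eq
    ... | inj₁ v = trans (sym (Fin.toℕ-↑ˡ v 1)) (cong Fin.toℕ (Fin.splitAt⁻¹-↑ˡ eq))
    ... | inj₂ Fin.zero = trans (sym (trans (Fin.toℕ-↑ʳ t Fin.zero) (+-identityʳ t)))
                            (cong Fin.toℕ (Fin.splitAt⁻¹-↑ʳ eq))

    construction′ : Construction (on-Fin (t + 1)) M
    construction′ = redraw
      (λ u v → subst₂ (λ x y → A (position (splitAt t u)) (position (splitAt t v)) ⇔ A x y)
                 (position-split u) (position-split v) (⇔-id _))
      (transport (↔-sym +↔⊎) (redraw drawn (star i targets i∉targets (union construction (point i)))))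

    N-faithful : ∀ u v {z} → N u ≡ N v → t ≤ z → z < n → A (position u) z → A (position v) z
    N-faithful (inj₁ u) (inj₁ v) eq = faithful eq
    N-faithful (inj₁ u) (inj₂ v) eq = contradiction eq (unused u)
    N-faithful (inj₂ u) (inj₁ v) eq = contradiction (sym eq) (unused v)
    N-faithful (inj₂ u) (inj₂ v) eq _ _ a = a

    M-faithful : Faithful M
    M-faithful {u} {v} {z} eq t<z z<n a = subst (λ x → A x z) (position-split v)
      (N-faithful (splitAt t u) (splitAt t v) eq (≤-trans (m≤m+n t 1) t<z) z<n
        (subst (λ x → A x z) (sym (position-split u)) a))

  sweep : ∀ {t} → 0 < t → t ≤ n → Stage t
  sweep {suc zero}    _ _   = first
  sweep {suc (suc t)} _ t<n = subst Stage (+-comm (suc t) 1) (step t<n (sweep (s≤s z≤n) (<⇒≤ t<n)))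

------------------------------------------------------------------------
-- Finite orders and permutations

-- A total preorder on a nonempty finite set has a least element.
least : ∀ {n} (_≲_ : Rel (Fin (suc n)) 0ℓ) → (∀ u v → u ≲ v ⊎ v ≲ u) →
        (∀ {u v w} → u ≲ v → v ≲ w → u ≲ w) → ∃[ u ] ∀ v → u ≲ v
least {zero} _≲_ total tr = Fin.zero , λ { Fin.zero → [ id , id ]′ (total Fin.zero Fin.zero) }
least {suc n} _≲_ total tr with least (λ u v → Fin.suc u ≲ Fin.suc v) (λ u v → total _ _) tr
... | u , u≤ with total Fin.zero (Fin.suc u)
...   | inj₁ p = Fin.zero , λ { Fin.zero → [ id , id ]′ (total Fin.zero Fin.zero) ; (Fin.suc v) → tr p (u≤ v) }
...   | inj₂ p = Fin.suc u , λ { Fin.zero → p ; (Fin.suc v) → u≤ v }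

-- The permutation π lists the elements in increasing order.
sort : ∀ {n} (_≲_ : Rel (Fin n) 0ℓ) → (∀ u v → u ≲ v ⊎ v ≲ u) →
       (∀ {u v w} → u ≲ v → v ≲ w → u ≲ w) →
       Σ[ π ∈ Permutation′ n ] ∀ i j → i Fin.< j → (π ⟨$⟩ʳ i) ≲ (π ⟨$⟩ʳ j)
sort {zero} _ _ _ = ↔-id _ , λ ()
sort {suc n} _≲_ total tr with least _≲_ total tr
... | u , u≤ with sort (λ v w → punchIn u v ≲ punchIn u w) (λ v w → total _ _) tr
...   | π , sorted = insert Fin.zero u π , λ
  { Fin.zero (Fin.suc j) _ → u≤ _
  ; (Fin.suc i) (Fin.suc j) (s≤s i<j) → sorted i j i<j
  }

permutation-injective : ∀ {n} (π : Permutation′ n) {i j} → π ⟨$⟩ʳ i ≡ π ⟨$⟩ʳ j → i ≡ j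
permutation-injective π eq = trans (sym (inverseˡ π)) (trans (cong (π ⟨$⟩ˡ_) eq) (inverseˡ π))

-- Every permutation arises by inserting the image of zero into a smaller one,
-- up to pointwise equality.
any-permutation? : ∀ {n} {P : Permutation′ n → Set} → (∀ {π σ} → π ≈ σ → P π → P σ) →
                   (∀ π → Dec (P π)) → Dec (∃ P)
any-permutation? {zero} resp P? = map′ (_ ,_) (λ (π , p) → resp (λ ()) p) (P? Perm.id)
any-permutation? {suc n} {P} resp P? = map′
  (λ (u , π , p) → insert Fin.zero u π , p)
  (λ (σ , p) → σ ⟨$⟩ʳ Fin.zero , remove Fin.zero σ , resp (λ i → sym (insert-remove Fin.zero σ i)) p)
  (any? λ u → any-permutation? (λ {π} {σ} eq → resp (insert-cong u π σ eq)) (λ π → P? (insert Fin.zero u π)))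
  where
  insert-cong : ∀ u (π σ : Permutation′ n) → π ≈ σ → insert Fin.zero u π ≈ insert Fin.zero u σ
  insert-cong u π σ eq Fin.zero    = refl
  insert-cong u π σ eq (Fin.suc i) = cong (punchIn u) (eq i)

------------------------------------------------------------------------
-- Order on the real line

open ℝ
open ClosedInterval

private
  half-pos : ∀ {ε} → 0ℚ ℚ.< ε → 0ℚ ℚ.< ½ ℚ.* ε
  half-pos 0<ε = ℚ.*-monoʳ-<-pos ½ 0<ε

  halves : ∀ z ε → (z ℚ.+ ½ ℚ.* ε) ℚ.+ ½ ℚ.* ε ≡ z ℚ.+ ε
  halves = solve 2 (λ z ε → (z :+ con ½ :* ε) :+ con ½ :* ε := z :+ ε) refl
    where open +-*-Solver

  p≤∣p∣ : ∀ p → p ℚ.≤ ℚ.∣ p ∣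
  p≤∣p∣ p with ℚ.≤-total 0ℚ p
  ... | inj₁ 0≤p = ℚ.≤-reflexive (sym (ℚ.0≤p⇒∣p∣≡p 0≤p))
  ... | inj₂ p≤0 = ℚ.≤-trans p≤0 (ℚ.0≤∣p∣ p)

  near : ∀ a b {δ} → ℚ.∣ a ℚ.- b ∣ ℚ.< δ → a ℚ.≤ b ℚ.+ δ
  near a b {δ} close = begin
    a              ≡⟨ solve 2 (λ a b → a := b :+ (a :- b)) refl a b ⟩
    b ℚ.+ (a ℚ.- b) ≤⟨ ℚ.+-monoʳ-≤ b (ℚ.≤-trans (p≤∣p∣ (a ℚ.- b)) (ℚ.<⇒≤ close)) ⟩
    b ℚ.+ δ        ∎
    where
    open ℚ.≤-Reasoning
    open +-*-Solver

≤ᴿ-trans : ∀ {x y z} → x ≤ᴿ y → y ≤ᴿ z → x ≤ᴿ z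
≤ᴿ-trans {x} {y} {z} x≤y y≤z ε 0<ε with x≤y (½ ℚ.* ε) (half-pos 0<ε) | y≤z (½ ℚ.* ε) (half-pos 0<ε)
... | M , p | N , q = M ⊔ N , λ n n≥ → begin
  seq x n                               ≤⟨ p n (m⊔n≤o⇒m≤o M N n≥) ⟩
  seq y n ℚ.+ ½ ℚ.* ε                   ≤⟨ ℚ.+-monoˡ-≤ (½ ℚ.* ε) (q n (m⊔n≤o⇒n≤o M N n≥)) ⟩
  (seq z n ℚ.+ ½ ℚ.* ε) ℚ.+ ½ ℚ.* ε     ≡⟨ halves (seq z n) ε ⟩
  seq z n ℚ.+ ε                         ∎
  where open ℚ.≤-Reasoning

-- At an index where both sequences have settled to within ε / 4, compare them
-- with tolerance ε / 2: either y ≤ x + ε eventually, or x lies below y from that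
-- index on.
≰ᴿ⇒≥ : ∀ {x y} → ¬ x ≤ᴿ y → y ≤ᴿ x
≰ᴿ⇒≥ {x} {y} x≰y ε 0<ε with cauchy x δ 0<δ | cauchy y δ 0<δ
  where
  δ = ½ ℚ.* (½ ℚ.* ε)
  0<δ = half-pos (half-pos 0<ε)
... | M , x-close | N , y-close = L , bound (seq y L ℚ.≤? seq x L ℚ.+ ½ ℚ.* ε)
  where
  L = M ⊔ N
  δ = ½ ℚ.* (½ ℚ.* ε)

  open ℚ.≤-Reasoning

  bound : Dec (seq y L ℚ.≤ seq x L ℚ.+ ½ ℚ.* ε) → ∀ n → L ≤ n → seq y n ℚ.≤ seq x n ℚ.+ ε
  bound (yes y≤x) n n≥ = begin
    seq y n                                ≤⟨ near (seq y n) (seq y L) (y-close n L (m⊔n≤o⇒n≤o M N n≥) (m≤n⊔m M N)) ⟩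
    seq y L ℚ.+ δ                          ≤⟨ ℚ.+-monoˡ-≤ δ y≤x ⟩
    (seq x L ℚ.+ ½ ℚ.* ε) ℚ.+ δ            ≤⟨ ℚ.+-monoˡ-≤ δ (ℚ.+-monoˡ-≤ (½ ℚ.* ε)
      (near (seq x L) (seq x n) (x-close L n (m≤m⊔n M N) (m⊔n≤o⇒m≤o M N n≥)))) ⟩
    ((seq x n ℚ.+ δ) ℚ.+ ½ ℚ.* ε) ℚ.+ δ    ≡⟨ solve 2 (λ x ε →
      let δ = con ½ :* (con ½ :* ε) in ((x :+ δ) :+ con ½ :* ε) :+ δ := x :+ ε) refl (seq x n) ε ⟩
    seq x n ℚ.+ ε                          ∎
    where open +-*-Solver
  bound (no y≰x) = contradiction x≤y x≰y
    where
    x≤y : x ≤ᴿ y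
    x≤y ε′ 0<ε′ = L , λ n n≥ → begin
      seq x n                       ≤⟨ near (seq x n) (seq x L) (x-close n L (m⊔n≤o⇒m≤o M N n≥) (m≤m⊔n M N)) ⟩
      seq x L ℚ.+ δ                 ≡⟨ solve 2 (λ x δ → x :+ δ := (x :+ (δ :+ δ)) :- δ) refl (seq x L) δ ⟩
      (seq x L ℚ.+ (δ ℚ.+ δ)) ℚ.- δ ≡⟨ cong (λ e → (seq x L ℚ.+ e) ℚ.- δ)
        (solve 1 (λ ε → con ½ :* ε :+ con ½ :* ε := ε) refl (½ ℚ.* ε)) ⟩
      (seq x L ℚ.+ ½ ℚ.* ε) ℚ.- δ   ≤⟨ ℚ.+-monoˡ-≤ (ℚ.- δ) (ℚ.<⇒≤ (ℚ.≰⇒> y≰x)) ⟩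
      seq y L ℚ.- δ                 ≤⟨ ℚ.+-monoˡ-≤ (ℚ.- δ)
        (near (seq y L) (seq y n) (y-close L n (m≤n⊔m M N) (m⊔n≤o⇒n≤o M N n≥))) ⟩
      (seq y n ℚ.+ δ) ℚ.- δ         ≡⟨ solve 2 (λ y δ → (y :+ δ) :- δ := y :+ con 0ℚ) refl (seq y n) δ ⟩
      seq y n ℚ.+ 0ℚ                ≤⟨ ℚ.+-monoʳ-≤ (seq y n) (ℚ.<⇒≤ 0<ε′) ⟩
      seq y n ℚ.+ ε′                ∎
      where open +-*-Solver

-- Among intervals of equal length the order of right endpoints follows that of
-- left endpoints.
right-mono : ∀ I J → length I ≃ᴿ length J → left I ≤ᴿ left J → right I ≤ᴿ right J
right-mono I J (I≤J , _) l≤ ε 0<ε with I≤J (½ ℚ.* ε) (half-pos 0<ε) | l≤ (½ ℚ.* ε) (half-pos 0<ε)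
... | M , p | N , q = M ⊔ N , λ n n≥ → begin
  seq (right I) n
    ≡⟨ solve 2 (λ l r → r := (r :- l) :+ l) refl (seq (left I) n) (seq (right I) n) ⟩
  (seq (right I) n ℚ.- seq (left I) n) ℚ.+ seq (left I) n
    ≤⟨ ℚ.+-mono-≤ (p n (m⊔n≤o⇒m≤o M N n≥)) (q n (m⊔n≤o⇒n≤o M N n≥)) ⟩
  ((seq (right J) n ℚ.- seq (left J) n) ℚ.+ ½ ℚ.* ε) ℚ.+ (seq (left J) n ℚ.+ ½ ℚ.* ε)
    ≡⟨ solve 3 (λ l r ε → ((r :- l) :+ con ½ :* ε) :+ (l :+ con ½ :* ε) := r :+ ε) refl
         (seq (left J) n) (seq (right J) n) ε ⟩
  seq (right J) n ℚ.+ ε ∎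
  where
  open ℚ.≤-Reasoning
  open +-*-Solver

------------------------------------------------------------------------
-- Umbrella orders of unit interval graphs

-- In the sequence π, whatever lies between two adjacent vertices is adjacent to
-- both.
Umbrella : ∀ {n} → Rel (Fin n) 0ℓ → Permutation′ n → Set
Umbrella _~_ π = ∀ i j k → i Fin.< j → j Fin.< k →
  (π ⟨$⟩ʳ i) ~ (π ⟨$⟩ʳ k) → (π ⟨$⟩ʳ i) ~ (π ⟨$⟩ʳ j) × (π ⟨$⟩ʳ j) ~ (π ⟨$⟩ʳ k)

-- Sorting by left endpoints gives an umbrella order: a common point of the
-- first and the last of three intervals lies in the middle one.
umbrella : ∀ G → UnitInterval G → ∃ (Umbrella (Graph._~_ G))
umbrella G (I , equal , intersect) = decidable-stable
  (any-permutation? {P = Umbrella _~_} (λ {π} {σ} → resp {π} {σ}) umbrella?)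
  (¬¬-map sorted (sequence² {λ u v → u ≲ v ⊎ v ≲ u} λ u v → ¬¬-map (total u v) ¬¬-excluded-middle))
  where
  open Graph G
  open RawMonad (¬¬-Monad {0ℓ}) using (rawApplicative)

  resp : ∀ {π σ} → π ≈ σ → Umbrella _~_ π → Umbrella _~_ σ
  resp eq U i j k rewrite sym (eq i) | sym (eq j) | sym (eq k) = U i j k

  umbrella? : ∀ π → Dec (Umbrella _~_ π)
  umbrella? π = all? λ i → all? λ j → all? λ k → (i Fin.<? j) →-dec (j Fin.<? k) →-dec
    ((_ ~? _) →-dec ((_ ~? _) ×-dec (_ ~? _)))

  -- Finitely many comparisons can be decided simultaneously under double negation.
  sequence² : ∀ {P : Vertex → Vertex → Set} → (∀ u v → ¬ ¬ P u v) → ¬ ¬ (∀ u v → P u v)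
  sequence² p = Fin.sequence rawApplicative (λ u → Fin.sequence rawApplicative (p u))

  infix 4 _≲_
  _≲_ : Rel Vertex 0ℓ
  u ≲ v = left (I u) ≤ᴿ left (I v)

  total : ∀ u v → Dec (u ≲ v) → u ≲ v ⊎ v ≲ u
  total u v (yes p) = inj₁ p
  total u v (no ¬p) = inj₂ (≰ᴿ⇒≥ {left (I u)} {left (I v)} ¬p)

  sorted : (∀ u v → u ≲ v ⊎ v ≲ u) → ∃ (Umbrella _~_)
  sorted compare = arrange (sort _≲_ compare
                     (λ {u} {v} {w} → ≤ᴿ-trans {left (I u)} {left (I v)} {left (I w)}))
    where
    arrange : (Σ[ π ∈ Permutation′ order ] ∀ i j → i Fin.< j → (π ⟨$⟩ʳ i) ≲ (π ⟨$⟩ʳ j)) → ∃ (Umbrella _~_)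
    arrange (π , ascending) = π , λ i j k i<j j<k i~k →
      split i<j j<k (proj₂ (⇒ (intersect (π ⟨$⟩ʳ i) (π ⟨$⟩ʳ k)) i~k))
      where
      J : Vertex → ClosedInterval
      J i = I (π ⟨$⟩ʳ i)

      distinct : ∀ {i j} → i Fin.< j → π ⟨$⟩ʳ i ≢ π ⟨$⟩ʳ j
      distinct {i} {j} i<j eq = Fin.<⇒≢ i<j (trans (sym (inverseˡ π)) (trans (cong (π ⟨$⟩ˡ_) eq) (inverseˡ π)))

      split : ∀ {i j k} → i Fin.< j → j Fin.< k → (∃[ x ] x ∈ᴿ J i × x ∈ᴿ J k) →
              (π ⟨$⟩ʳ i) ~ (π ⟨$⟩ʳ j) × (π ⟨$⟩ʳ j) ~ (π ⟨$⟩ʳ k)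
      split {i} {j} {k} i<j j<k (x , (li≤x , x≤ri) , (lk≤x , x≤rk)) =
        ⇐ (intersect (π ⟨$⟩ʳ i) (π ⟨$⟩ʳ j)) (distinct i<j , x , (li≤x , x≤ri) , (lj≤x , x≤rj)) ,
        ⇐ (intersect (π ⟨$⟩ʳ j) (π ⟨$⟩ʳ k)) (distinct j<k , x , (lj≤x , x≤rj) , (lk≤x , x≤rk))
        where
        lj≤x : left (J j) ≤ᴿ x
        lj≤x = ≤ᴿ-trans {left (J j)} {left (J k)} {x} (ascending j k j<k) lk≤x

        x≤rj : x ≤ᴿ right (J j)
        x≤rj = ≤ᴿ-trans {x} {right (J i)} {right (J j)} x≤ri
          (right-mono (J i) (J j) (equal (π ⟨$⟩ʳ i) (π ⟨$⟩ʳ j)) (ascending i j i<j))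

-- A representation of G by positions and a map reach, in the sense of Adjacent.
-- Positions from order on are not vertices; there reach a is suc a.
record Layout (G : Graph) : Set where
  open Graph G
  field
    vertex   : Permutation′ order
    reach    : ℕ → ℕ
    mono     : ∀ {a b} → a ≤ b → reach a ≤ reach b
    infl     : ∀ a → a < reach a
    inside   : ∀ {a} → suc a < reach a → a < order
    adjacent : ∀ i j → (vertex ⟨$⟩ʳ i ~ vertex ⟨$⟩ʳ j) ⇔ Adjacent reach (Fin.toℕ i) (Fin.toℕ j)

layout : ∀ G → ∃ (Umbrella (Graph._~_ G)) → Layout G
layout G (π , U) = record
  { vertex   = π
  ; reach    = reach
  ; mono     = mono
  ; infl     = infl
  ; inside   = λ {a} lt → proj₁ (covered ≤-refl lt)
  ; adjacent = λ i j → mk⇔ (to i j) (from i j)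
  }
  where
  open Graph G
  n = order

  -- Adjacency of the vertices at positions a and b; it fails unless both are below
  -- n.
  R : Rel ℕ 0ℓ
  R a b = Σ[ p ∈ a < n ] Σ[ q ∈ b < n ] (π ⟨$⟩ʳ fromℕ< p) ~ (π ⟨$⟩ʳ fromℕ< q)

  R? : ∀ a b → Dec (R a b)
  R? a b with a <? n | b <? n
  ... | no ¬p | _     = no (¬p ∘ proj₁)
  ... | yes p | no ¬q = no (¬q ∘ proj₁ ∘ proj₂)
  ... | yes p | yes q = map′ (λ r → p , q , r) (λ (_ , _ , r) → r) (_ ~? _)

  R-umbrella : ∀ {a b c} → a < b → b < c → R a c → R a b × R b c
  R-umbrella {a} {b} {c} a<b b<c (p , q , r) =
    let b<n = <-trans b<c q
        r₁ , r₂ = U (fromℕ< p) (fromℕ< b<n) (fromℕ< q)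
                    (subst₂ _<_ (sym (Fin.toℕ-fromℕ< p)) (sym (Fin.toℕ-fromℕ< b<n)) a<b)
                    (subst₂ _<_ (sym (Fin.toℕ-fromℕ< b<n)) (sym (Fin.toℕ-fromℕ< q)) b<c) r
    in (p , b<n , r₁) , (b<n , q , r₂)

  abstract
    failure : ∀ a → ∃[ b ] suc a ≤ b × ¬ R a b × ∀ {x} → suc a ≤ x → x < b → R a x
    failure a = first-failure (R? a) n (suc a) λ (_ , q , _) → <⇒≱ q (m≤m+n n (suc a))

  reach : ℕ → ℕ
  reach a = proj₁ (failure a)

  infl : ∀ a → a < reach a
  infl a = proj₁ (proj₂ (failure a))

  ¬R-reach : ∀ a → ¬ R a (reach a)
  ¬R-reach a = proj₁ (proj₂ (proj₂ (failure a)))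

  covered : ∀ {a x} → a < x → x < reach a → R a x
  covered {a} = proj₂ (proj₂ (proj₂ (failure a)))

  R⇒< : ∀ {a b} → a < b → R a b → b < reach a
  R⇒< {a} {b} a<b r with <-cmp b (reach a)
  ... | tri< lt _ _ = lt
  ... | tri≈ _ refl _ = contradiction r (¬R-reach a)
  ... | tri> _ _ gt = contradiction (proj₁ (R-umbrella (infl a) gt r)) (¬R-reach a)

  mono : ∀ {a b} → a ≤ b → reach a ≤ reach b
  mono {a} {b} a≤b with m≤n⇒m<n∨m≡n a≤b
  ... | inj₂ refl = ≤-refl
  ... | inj₁ a<b  = ≮⇒≥ λ lt → ¬R-reach b
        (proj₂ (R-umbrella a<b (infl b) (covered (<-trans a<b (infl b)) lt)))

  R-toℕ : ∀ i j → (π ⟨$⟩ʳ i) ~ (π ⟨$⟩ʳ j) → R (Fin.toℕ i) (Fin.toℕ j)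
  R-toℕ i j = λ r → Fin.toℕ<n i , Fin.toℕ<n j ,
    subst₂ (λ x y → (π ⟨$⟩ʳ x) ~ (π ⟨$⟩ʳ y)) (sym (Fin.fromℕ<-toℕ i _)) (sym (Fin.fromℕ<-toℕ j _)) r

  R-toℕ⁻¹ : ∀ i j → R (Fin.toℕ i) (Fin.toℕ j) → (π ⟨$⟩ʳ i) ~ (π ⟨$⟩ʳ j)
  R-toℕ⁻¹ i j (_ , _ , r) =
    subst₂ (λ x y → (π ⟨$⟩ʳ x) ~ (π ⟨$⟩ʳ y)) (Fin.fromℕ<-toℕ i _) (Fin.fromℕ<-toℕ j _) r

  to : ∀ i j → (π ⟨$⟩ʳ i) ~ (π ⟨$⟩ʳ j) → Adjacent reach (Fin.toℕ i) (Fin.toℕ j)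
  to i j r with <-cmp (Fin.toℕ i) (Fin.toℕ j)
  ... | tri< lt _ _ = inj₁ (lt , R⇒< lt (R-toℕ i j r))
  ... | tri≈ _ eq _ = contradiction (subst (λ k → (π ⟨$⟩ʳ i) ~ (π ⟨$⟩ʳ k)) (sym (Fin.toℕ-injective eq)) r) ~-irr
  ... | tri> _ _ gt = inj₂ (gt , R⇒< gt (R-toℕ j i (~-sym r)))

  from : ∀ i j → Adjacent reach (Fin.toℕ i) (Fin.toℕ j) → (π ⟨$⟩ʳ i) ~ (π ⟨$⟩ʳ j)
  from i j (inj₁ (lt , r)) = R-toℕ⁻¹ i j (covered lt r)
  from i j (inj₂ (gt , r)) = ~-sym (R-toℕ⁻¹ j i (covered gt r))

------------------------------------------------------------------------
-- Excluding a unit interval graph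

module _ {G : Graph} (LG : Layout G) where

  private
    module G = Graph G
    open Layout LG

  -- G contains every unit interval graph on h vertices once some window is dense
  -- for h.
  dense⇒≼ : ∀ {H} → Layout H → ∀ w → Windows.Dense reach mono infl (Graph.order H) w → H ≼ G
  dense⇒≼ {H} LH w dense = mk↣ place-injective , place-~
    where
    module H = Graph H
    module LH = Layout LH
    module Col = Columns LH.reach LH.mono LH.infl

    sorting : Σ[ π ∈ Permutation′ H.order ] ∀ i j → i Fin.< j → Fin.toℕ (π ⟨$⟩ʳ i) Col.⊑ Fin.toℕ (π ⟨$⟩ʳ j)
    sorting = sort (Col._⊑_ on Fin.toℕ) (λ u v → Col.⊑-total _ _) Col.⊑-trans

    σ = proj₁ sorting

    rank-injective : ∀ {y z} → σ ⟨$⟩ˡ y ≡ σ ⟨$⟩ˡ z → y ≡ z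
    rank-injective = permutation-injective (↔-sym σ)

    rank-⊑ : ∀ {y z} → (σ ⟨$⟩ˡ y) Fin.< (σ ⟨$⟩ˡ z) → Fin.toℕ y Col.⊑ Fin.toℕ z
    rank-⊑ lt = subst₂ (λ a b → Fin.toℕ a Col.⊑ Fin.toℕ b) (inverseʳ σ) (inverseʳ σ) (proj₂ sorting _ _ lt)

    module E = Embedding reach mono infl LH.reach LH.mono LH.infl
      Fin.toℕ Fin.toℕ<n Fin.toℕ-injective (σ ⟨$⟩ˡ_) rank-injective rank-⊑ w dense

    position : H.Vertex → Fin H.order
    position v = LH.vertex ⟨$⟩ˡ v

    embed<n : ∀ i → E.embed i < G.order
    embed<n i = inside (E.embed-bound i)

    seat : H.Vertex → Fin G.order
    seat v = fromℕ< (embed<n (position v))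

    place : H.Vertex → G.Vertex
    place v = vertex ⟨$⟩ʳ seat v

    place-injective : ∀ {u v} → place u ≡ place v → u ≡ v
    place-injective eq = permutation-injective (↔-sym LH.vertex)
      (E.embed-injective (Fin.fromℕ<-injective _ _ (embed<n _) (embed<n _) (permutation-injective vertex eq)))

    place-~ : ∀ u v → (u H.~ v) ⇔ (place u G.~ place v)
    place-~ u v = mk⇔
      (λ u~v → ⇐ (adjacent _ _) (subst₂ (Adjacent reach) (sym (seated u)) (sym (seated v))
        (E.embed-~ (⇒ (LH.adjacent _ _) (subst₂ H._~_ (sym (inverseʳ LH.vertex)) (sym (inverseʳ LH.vertex)) u~v)))))
      (λ u~v → subst₂ H._~_ (inverseʳ LH.vertex) (inverseʳ LH.vertex) (⇐ (LH.adjacent _ _)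
        (E.embed-~⁻¹ (subst₂ (Adjacent reach) (seated u) (seated v) (⇒ (adjacent _ _) u~v)))))
      where
      seated : ∀ v → Fin.toℕ (seat v) ≡ E.embed (position v)
      seated v = Fin.toℕ-fromℕ< (embed<n (position v))

  -- Without dense windows, the elimination order makes all cuts of G bounded.
  sparse⇒constructible : ∀ h → (∀ w → ¬ Windows.Dense reach mono infl h w) →
                         ConstructibleWith (suc (palette h)) G
  sparse⇒constructible h sparse with m≤n⇒m<n∨m≡n (z≤n {G.order})
  ... | inj₂ 0≡n = inj₁ (sym 0≡n)
  ... | inj₁ 0<n = realises G (S.Stage.construction (S.sweep 0<n ≤-refl)) (vertex ↔-∘ σ) drawn
    where
    n = G.order
    open Windows reach mono infl h
    module Col = Columns reach mono infl

    sorting : Σ[ π ∈ Permutation′ n ] ∀ i j → i Fin.< j → Fin.toℕ (π ⟨$⟩ʳ i) ≲ Fin.toℕ (π ⟨$⟩ʳ j)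
    sorting = sort (_≲_ on Fin.toℕ) (λ u v → ≲-total (Fin.toℕ u) (Fin.toℕ v))
                      (λ {u} {v} {w} → ≲-trans {Fin.toℕ u} {Fin.toℕ v} {Fin.toℕ w})

    σ = proj₁ sorting

    -- The position of the t-th vertex in the elimination order.  Values of t from n
    -- on are irrelevant.
    r : ℕ → ℕ
    r t with t <? n
    ... | yes t<n = Fin.toℕ (σ ⟨$⟩ʳ fromℕ< t<n)
    ... | no  _   = t

    r-< : ∀ {t} (t<n : t < n) → r t ≡ Fin.toℕ (σ ⟨$⟩ʳ fromℕ< t<n)
    r-< {t} t<n with t <? n
    ... | yes _   = refl
    ... | no  t≮n = contradiction t<n t≮n

    r-toℕ : ∀ i → r (Fin.toℕ i) ≡ Fin.toℕ (σ ⟨$⟩ʳ i)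
    r-toℕ i = trans (r-< (Fin.toℕ<n i)) (cong (λ j → Fin.toℕ (σ ⟨$⟩ʳ j)) (Fin.fromℕ<-toℕ i _))

    r-sorted : ∀ t z → t < z → z < n → r t ≲ r z
    r-sorted t z t<z z<n = subst₂ _≲_ (sym (r-< (<-trans t<z z<n))) (sym (r-< z<n))
      (proj₂ sorting _ _ (subst₂ _<_ (sym (Fin.toℕ-fromℕ< _)) (sym (Fin.toℕ-fromℕ< z<n)) t<z))

    r-injective : ∀ {t z} → t < n → z < n → r t ≡ r z → t ≡ z
    r-injective t<n z<n eq = Fin.fromℕ<-injective _ _ t<n z<n
      (permutation-injective σ (Fin.toℕ-injective (trans (sym (r-< t<n)) (trans eq (r-< z<n)))))

    block-mono : ∀ t z → t ≤ z → z < n → block (r t) ≤ block (r z)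
    block-mono t z t≤z z<n with m≤n⇒m<n∨m≡n t≤z
    ... | inj₁ t<z  = ≲-block {r t} {r z} (r-sorted t z t<z z<n)
    ... | inj₂ refl = ≤-refl

    adjacent? : Decidable (Col._~_ on r)
    adjacent? t u = (r t <? r u ×-dec r u <? reach (r t)) ⊎-dec (r u <? r t ×-dec r t <? reach (r u))

    irreflexive : ∀ {x} → ¬ r x Col.~ r x
    irreflexive a = Col.~-irrefl a refl

    cut-colour : ℕ → ℕ → Fin (palette h)
    cut-colour t x = colour sparse (block (r t)) (r x)

    cut-twins : ∀ {t x y z} → x < t → y < t → t ≤ z → z < n → cut-colour t x ≡ cut-colour t y →
                r x Col.~ r z → r y Col.~ r z
    cut-twins {t} {x} {y} {z} x<t y<t t≤z z<n =
      colour-twins sparse {block (r t)} {r x} {r y} {r z}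
        (block-mono x t (<⇒≤ x<t) t<n) (block-mono y t (<⇒≤ y<t) t<n) (block-mono t z t≤z z<n)
        (r-sorted x z (<-≤-trans x<t t≤z) z<n) (r-sorted y z y<z z<n)
        (λ eq → <⇒≢ y<z (r-injective (<-trans y<z z<n) z<n eq))
      where
      y<z = <-≤-trans y<t t≤z
      t<n = ≤-<-trans t≤z z<n

    module S = Sweep {n = n} (Col._~_ on r) adjacent? Col.~-sym irreflexive cut-colour cut-twins

    drawn : ∀ u v → S.on-Fin n u v ⇔ ((vertex ⟨$⟩ʳ (σ ⟨$⟩ʳ u)) G.~ (vertex ⟨$⟩ʳ (σ ⟨$⟩ʳ v)))
    drawn u v = subst₂ (λ a b → Adjacent reach a b ⇔ ((vertex ⟨$⟩ʳ (σ ⟨$⟩ʳ u)) G.~ (vertex ⟨$⟩ʳ (σ ⟨$⟩ʳ v))))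
      (sym (r-toℕ u)) (sym (r-toℕ v)) (⇔-sym (adjacent (σ ⟨$⟩ʳ u) (σ ⟨$⟩ʳ v)))

theorem7 : {ℓ : Level} (X : Pred Graph ℓ) →
    Hereditary X → ProperSubclassOfUnitInterval X →
    ∃[ c ] (∀ G → X G → CliqueWidthAtMost c G)
theorem7 X hereditary (X⊆UI , H , H-ui , H∉X) = suc (palette h) , λ G G∈X →
  let LG = layout G (umbrella G (X⊆UI G∈X))
  in suc (palette h) , ≤-refl , sparse⇒constructible LG h
       (λ w dense → H∉X (hereditary G H (dense⇒≼ LG LH w dense) G∈X))
  where
  h = Graph.order H
  LH = layout H (umbrella H H-ui)
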